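{- Let $n\ge 1$ be an integer and let $[\beta(i,j)]$ be the $n\times n$ real symmetric matrix with $(i,j)$th entry $\beta(i,j)$, $1\le i,j\le n$, where $\beta$ is the beta function. Then $$\mathrm{Inertia}\left([\beta(i,j)]\right)=\begin{cases}\left(\dfrac n2,\,0,\,\dfrac n2\right) & \text{if } n \text{ is even},\\[2mm] \left(\dfrac{n+1}{2},\,0,\,\dfrac{n-1}{2}\right) & \text{if } n\text{ is odd}.\end{cases}$$
   Context: For $x,y>0$, $\beta(x,y)=\frac{\Gamma(x)\Gamma(y)}{\Gamma(x+y)}$, where $\Gamma$ is the gamma function; for positive integers $i,j$, $\beta(i,j)=\frac{(i-1)!(j-1)!}{(i+j-1)!}$. For a real symmetric matrix $A$, let $\pi(A),\xi(A),\nu(A)$ denote the number of positive, zero and negative eigenvalues of $A$, respectively (counted with multiplicity). The inertia of $A$ is the triplet $\mathrm{Inertia}(A)=(\pi(A),\xi(A),\nu(A))$. -}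

module Defs where

open import Level using (Level; _⊔_) renaming (suc to lsuc)
open import Algebra.Bundles using (CommutativeRing; Semiring)
open import Algebra.Core using (Op₁)
import Algebra.Definitions.RawSemiring as RawSemiringDefs
open import Data.Bool.Base using (if_then_else_)
open import Data.Fin.Base using (Fin; zero; suc; toℕ; punchIn)
import Data.Fin.Properties as Fin
open import Data.Nat.Base using (ℕ; zero; suc; _∸_; _!) renaming (_+_ to _+ℕ_)
open import Data.Product.Base using (_×_; _,_; ∃)
open import Data.Vec.Base using (Vec; count; lookup)
open import Relation.Binary.Core using (Rel)
open import Relation.Binary.Structures using (IsStrictTotalOrder)
import Relation.Binary.Construct.StrictToNonStrict as StrictToNonStrict
open import Relation.Binary.PropositionalEquality.Core using (_≡_)
open import Relation.Nullary.Decidable.Core using (does)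
open import Relation.Unary using (Pred)

-- The classical axioms of the real numbers: a Dedekind-complete, totally
-- ordered field, up to a setoid equality.  Classically this determines ℝ up
-- to unique isomorphism.  `sup` together with decidable comparison is
-- non-constructive, so no closed instance is constructed here; given excluded
-- middle, the usual Cauchy reals form one.
record Reals (c ℓ₁ ℓ₂ : Level) : Set (lsuc (c ⊔ ℓ₁ ⊔ ℓ₂)) where
  field
    commutativeRing : CommutativeRing c ℓ₁

  open CommutativeRing commutativeRing public

  infix  4 _<_
  infix  9 _⁻¹

  field
    _<_                : Rel Carrier ℓ₂
    isStrictTotalOrder : IsStrictTotalOrder _≈_ _<_
    -- Total for convenience; the value at 0# is unspecified.
    _⁻¹                : Op₁ Carrier
    0<1                : 0# < 1#
    *-inverseʳ         : ∀ x → x ≉ 0# → x * x ⁻¹ ≈ 1#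
    +-monoʳ-<          : ∀ z {x y} → x < y → z + x < z + y
    *-positive         : ∀ {x y} → 0# < x → 0# < y → 0# < x * y

  open IsStrictTotalOrder isStrictTotalOrder public
    using (compare; _≟_; _<?_)

  open StrictToNonStrict _≈_ _<_ public
    using (_≤_)

  UpperBound : ∀ {p} → Pred Carrier p → Pred Carrier (c ⊔ ℓ₁ ⊔ ℓ₂ ⊔ p)
  UpperBound P u = ∀ x → P x → x ≤ u

  field
    sup : ∀ (P : Pred Carrier (c ⊔ ℓ₁ ⊔ ℓ₂)) → ∃ P → ∃ (UpperBound P) →
          ∃ λ s → UpperBound P s × (∀ u → UpperBound P u → s ≤ u)

module _ {c ℓ₁ ℓ₂ : Level} (ℝ : Reals c ℓ₁ ℓ₂) where

  open Reals ℝ hiding (zero)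
  open RawSemiringDefs (Semiring.rawSemiring semiring) using (sum; product; _^_)
    renaming (_×_ to _·_)

  Matrix : ℕ → Set c
  Matrix n = Fin n → Fin n → Carrier

  -- Laplace expansion along the first row.
  det : ∀ {n} → Matrix n → Carrier
  det {zero}  A = 1#
  det {suc n} A = sum λ j →
    (- 1#) ^ toℕ j * (A zero j * det (λ i k → A (suc i) (punchIn j k)))

  scalarMatrix : ∀ {n} → Carrier → Matrix n
  scalarMatrix x i j = if does (i Fin.≟ j) then x else 0#

  charPoly : ∀ {n} → Matrix n → Carrier → Carrier
  charPoly A x = det λ i j → scalarMatrix x i j - A i j

  -- μs lists all the eigenvalues of A with multiplicity, i.e.
  -- det (xI - A) = ∏ᵢ (x - μᵢ).  Equality of polynomial functions is
  -- equality of polynomials, ℝ being infinite; hence μs is unique up to order.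
  IsSpectrum : ∀ {n} → Matrix n → Vec Carrier n → Set (c ⊔ ℓ₁)
  IsSpectrum A μs = ∀ x → charPoly A x ≈ product λ i → x - lookup μs i

  -- The relation Inertia(A) = (π , ξ , ν).  It asserts in particular that A
  -- has n real eigenvalues, as every real symmetric matrix does.
  HasInertia : ∀ {n} → Matrix n → ℕ × ℕ × ℕ → Set (c ⊔ ℓ₁)
  HasInertia {n} A (π , ξ , ν) = ∃ λ (μs : Vec Carrier n) →
    IsSpectrum A μs ×
    count (0# <?_) μs ≡ π ×
    count (_≟ 0#)  μs ≡ ξ ×
    count (_<? 0#) μs ≡ ν

  fromℕ : ℕ → Carrier
  fromℕ k = k · 1#

  -- The beta function at positive integers:
  -- Γ(i)Γ(j)/Γ(i+j) = (i-1)!(j-1)!/(i+j-1)!.  Not meaningful at i = 0 or j = 0.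
  β : ℕ → ℕ → Carrier
  β i j = fromℕ ((i ∸ 1) !) * fromℕ ((j ∸ 1) !) * fromℕ ((i +ℕ j ∸ 1) !) ⁻¹

  -- Fin n counts from 0, the rows and columns of the matrix from 1.
  betaMatrix : (n : ℕ) → Matrix n
  betaMatrix n i j = β (suc (toℕ i)) (suc (toℕ j))

{-# OPTIONS --safe #-}
module Submission where

open import Defs
open import Level using (Level; _⊔_)
open import Algebra.Bundles using (CommutativeRing; Semiring)
import Algebra.Definitions.RawSemiring as RawSemiringDefs
import Algebra.Properties.CommutativeMonoid.Sum as CommutativeMonoidSum
import Algebra.Solver.Ring
open import Algebra.Solver.Ring.AlmostCommutativeRing
  using (fromCommutativeRing; _-Raw-AlmostCommutative⟶_)
open import Data.Bool.Base using (if_then_else_)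
open import Data.Empty using (⊥-elim)
open import Data.Fin.Base using (Fin; zero; suc; toℕ; punchIn; punchOut; _↑ˡ_; _↑ʳ_)
import Data.Fin.Properties as Fin
open import Data.Integer.Base as ℤ using (ℤ; +_; -[1+_])
import Data.Integer.Properties as ℤ
open import Data.Maybe.Base using (Maybe; nothing; just)
open import Data.Nat.Base as ℕ using (ℕ; zero; suc; s≤s; z≤n; _!; ⌊_/2⌋; ⌈_/2⌉)
open import Data.Nat.Divisibility using (_∣_; divides)
open import Data.Nat.DivMod using (_/_; m*n/n≡m)
import Data.Nat.Properties as ℕ
open import Data.Product.Base using (_×_; _,_; ∃; proj₁; proj₂)
open import Data.Sign.Base as Sign using ()
open import Data.Sum.Base using (_⊎_; inj₁; inj₂; [_,_]′)
open import Data.Unit.Polymorphic.Base using (⊤; tt)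
open import Data.Vec.Base as Vec using (Vec; []; _∷_; tabulate; lookup; count)
open import Data.Vec.Functional using (Vector; tail; insertAt; _++_) renaming (_∷_ to _◂_)
open import Data.Vec.Functional.Properties using (lookup-++ˡ; lookup-++ʳ)
import Data.Vec.Properties as Vec
open import Function.Base using (_∘_)
open import Relation.Binary.Bundles using (StrictPartialOrder)
open import Relation.Binary.Definitions using (tri<; tri≈; tri>)
open import Relation.Binary.PropositionalEquality.Core as ≡ using (_≡_)
open import Relation.Binary.Structures using (IsStrictTotalOrder)
open import Relation.Nullary.Decidable using (yes; no; ¬?; decidable-stable; dec-true; dec-false)
open import Relation.Nullary.Negation.Core using (¬_)
open import Relation.Unary using (Pred; Decidable)

-- With rows and columns counted from 0, the beta matrix has the explicit factorisation
--   i! j! / (i + j + 1)! = Σ_m (-1)^m (2m + 1) ℓ(i,m) ℓ(j,m),  ℓ(i,m) = (i!)² / ((i - m)! (i + m + 1)!),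
-- coming from the Bessel polynomials, which are orthogonal for the moments 1/(n + 1)!.  As ℓ is
-- triangular, the quadratic form is congruent to a diagonal one with alternating signs, and by
-- Sylvester's law of inertia the eigenvalues have the same signs.
--
-- That there are n real eigenvalues at all is the spectral theorem.  Orthogonal eigenvectors are found
-- one after the other: λ, the supremum of the Rayleigh quotients on the complement of those already
-- found, is an eigenvalue there, for otherwise λ - A would be invertible and positive semidefinite on
-- the complement, hence bounded below by some ε > 0, and λ - ε would be a smaller upper bound.  If P
-- has these eigenvectors vᵢ as rows, then P Pᵀ = diag (vᵢ ∙ vᵢ) and P (x - A) Pᵀ =
-- diag ((x - μᵢ) (vᵢ ∙ vᵢ)), so multiplicativity of det yields the characteristic polynomial without
-- normalising the vectors.

-- That an injective λ - A is bounded below on the unit sphere is usually a matter of compactness.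
-- Here Gaussian elimination takes its place: it yields either a kernel vector or a derivation of
-- every coordinate of w as a linear combination of the values of the rows at w, and from such a
-- derivation a bound of w ∙ w by a multiple of the sum of their squares can be read off. What is
-- needed is a bound by the form w ∙ B w, where B = λ - A, and semidefiniteness supplies the link: B
-- w ∙ B w ≤ K (w ∙ B w) on the complement. To avoid choosing a basis of the complement, B is
-- altered by rank-one terms; elimination then runs on all n coordinates, and a kernel vector is
-- automatically orthogonal to the eigenvectors already found. For the beta matrix, both sides of
-- the factorisation agree at j = 0 and satisfy the same first-order recurrence in j. With
-- denominators cleared, the closed form of ℓ and its factorials of differences never have to be
-- handled.

-- A ring solver with integer coefficients.

module IntegerSolver {c ℓ} (R : CommutativeRing c ℓ) where
  open CommutativeRing R
  open import Algebra.Properties.Semiring.Mult.TCOptimised semiring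
    using (×-homo-+; ×1-homo-*; 1+×) renaming (_×_ to _·_)
  open import Algebra.Properties.Ring ring
  open import Algebra.Properties.AbelianGroup +-abelianGroup using (⁻¹-∙-comm; ⁻¹-involutive)
  open import Algebra.Properties.CommutativeSemigroup +-commutativeSemigroup using (interchange)
  open import Relation.Binary.Reasoning.Setoid setoid

  -- With this variant of the multiples, `1 · 1#` computes to `1#`. The solver's constants 0, 1 and
  -- 2 are therefore `0#`, `1#` and `1# + 1#` by computation, which lets its answers match the goals
  -- directly.
  fromℤ : ℤ → Carrier
  fromℤ (+ n)    = n · 1#
  fromℤ -[1+ n ] = - (suc n · 1#)

  private
    fromℤ-neg : ∀ i → fromℤ (ℤ.- i) ≈ - fromℤ i
    fromℤ-neg (+ zero)  = sym -0#≈0#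
    fromℤ-neg (+ suc n) = refl
    fromℤ-neg -[1+ n ]  = sym (⁻¹-involutive _)

    fromℤ-⊖ : ∀ m n → fromℤ (m ℤ.⊖ n) ≈ m · 1# - n · 1#
    fromℤ-⊖ zero    zero    = sym (-‿inverseʳ 0#)
    fromℤ-⊖ zero    (suc n) = sym (+-identityˡ _)
    fromℤ-⊖ (suc m) zero    = sym (trans (+-congˡ -0#≈0#) (+-identityʳ _))
    fromℤ-⊖ (suc m) (suc n) = begin
      fromℤ (suc m ℤ.⊖ suc n)            ≡⟨ ≡.cong fromℤ (ℤ.[1+m]⊖[1+n]≡m⊖n m n) ⟩
      fromℤ (m ℤ.⊖ n)                    ≈⟨ fromℤ-⊖ m n ⟩
      m · 1# - n · 1#                    ≈⟨ +-identityˡ _ ⟨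
      0# + (m · 1# - n · 1#)             ≈⟨ +-congʳ (-‿inverseʳ 1#) ⟨
      1# - 1# + (m · 1# - n · 1#)        ≈⟨ interchange _ _ _ _ ⟩
      1# + m · 1# + (- 1# + - (n · 1#))  ≈⟨ +-congˡ (⁻¹-∙-comm _ _) ⟩
      1# + m · 1# - (1# + n · 1#)        ≈⟨ +-cong (1+× m 1#) (-‿cong (1+× n 1#)) ⟨
      suc m · 1# - suc n · 1#            ∎

    fromℤ-+ : ∀ i j → fromℤ (i ℤ.+ j) ≈ fromℤ i + fromℤ j
    fromℤ-+ (+ m)    (+ n)    = ×-homo-+ 1# m n
    fromℤ-+ (+ m)    -[1+ n ] = fromℤ-⊖ m (suc n)
    fromℤ-+ -[1+ m ] (+ n)    = trans (fromℤ-⊖ n (suc m)) (+-comm _ _)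
    fromℤ-+ -[1+ m ] -[1+ n ] = begin
      - (suc (suc (m ℕ.+ n)) · 1#)     ≡⟨ ≡.cong (λ k → - (suc k · 1#)) (ℕ.+-suc m n) ⟨
      - ((suc m ℕ.+ suc n) · 1#)       ≈⟨ -‿cong (×-homo-+ 1# (suc m) (suc n)) ⟩
      - (suc m · 1# + suc n · 1#)      ≈⟨ ⁻¹-∙-comm _ _ ⟨
      - (suc m · 1#) - (suc n · 1#)    ∎

    fromℤ-+◃ : ∀ n → fromℤ (Sign.+ ℤ.◃ n) ≈ n · 1#
    fromℤ-+◃ zero    = refl
    fromℤ-+◃ (suc n) = refl

    fromℤ--◃ : ∀ n → fromℤ (Sign.- ℤ.◃ n) ≈ - (n · 1#)
    fromℤ--◃ zero    = sym -0#≈0#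
    fromℤ--◃ (suc n) = refl

    fromℤ-* : ∀ i j → fromℤ (i ℤ.* j) ≈ fromℤ i * fromℤ j
    fromℤ-* (+ m)    (+ n)    = trans (fromℤ-+◃ (m ℕ.* n)) (×1-homo-* m n)
    fromℤ-* (+ m)    -[1+ n ] = trans (fromℤ--◃ (m ℕ.* suc n))
      (trans (-‿cong (×1-homo-* m (suc n))) (-‿distribʳ-* _ _))
    fromℤ-* -[1+ m ] (+ n)    = trans (fromℤ--◃ (suc m ℕ.* n))
      (trans (-‿cong (×1-homo-* (suc m) n)) (-‿distribˡ-* _ _))
    fromℤ-* -[1+ m ] -[1+ n ] = trans (fromℤ-+◃ (suc m ℕ.* suc n))
      (trans (×1-homo-* (suc m) (suc n)) (trans (sym (⁻¹-involutive _))
        (trans (-‿cong (-‿distribˡ-* _ _)) (-‿distribʳ-* _ _))))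

    homomorphism : ℤ.+-*-rawRing -Raw-AlmostCommutative⟶ fromCommutativeRing R
    homomorphism = record
      { ⟦_⟧    = fromℤ
      ; +-homo = fromℤ-+
      ; *-homo = fromℤ-*
      ; -‿homo = fromℤ-neg
      ; 0-homo = refl
      ; 1-homo = refl
      }

    equal? : ∀ i j → Maybe (fromℤ i ≈ fromℤ j)
    equal? i j with i ℤ.≟ j
    ... | yes i≡j = just (reflexive (≡.cong fromℤ i≡j))
    ... | no  _   = nothing

  open Algebra.Solver.Ring ℤ.+-*-rawRing (fromCommutativeRing R) homomorphism equal? public
    using (solve; _:=_; _:+_; _:*_; _:-_; :-_; con)

-- Ordered field arithmetic and finite sums.

module RealArithmetic {c ℓ₁ ℓ₂ : Level} (ℝ : Reals c ℓ₁ ℓ₂) where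

  open Reals ℝ public hiding (zero)
  open IntegerSolver commutativeRing public
  open IsStrictTotalOrder isStrictTotalOrder public
    using (isStrictPartialOrder) renaming
    (trans to <-trans; irrefl to <-irrefl; <-respʳ-≈ to <-respʳ; <-respˡ-≈ to <-respˡ)

  ℝ-strictPartialOrder : StrictPartialOrder c ℓ₁ ℓ₂
  ℝ-strictPartialOrder = record { isStrictPartialOrder = isStrictPartialOrder }

  open import Relation.Binary.Reasoning.StrictPartialOrder ℝ-strictPartialOrder public
  open import Algebra.Properties.Semiring.Sum semiring public
    using (sum; sum-cong-≋; sum-remove; ∑-distrib-+; ∑-comm; *-distribˡ-sum; *-distribʳ-sum; sum-replicate-zero)
  open import Algebra.Properties.Ring ring public using (-0#≈0#)
  open import Relation.Binary.Construct.StrictToNonStrict _≈_ _<_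
    using () renaming (total to mk-total; trans to mk-trans; antisym to mk-antisym)

  2# : Carrier
  2# = 1# + 1#

  ≤-refl : ∀ {x} → x ≤ x
  ≤-refl = inj₂ refl

  ≤-trans : ∀ {x y z} → x ≤ y → y ≤ z → x ≤ z
  ≤-trans = mk-trans isEquivalence (<-respʳ , <-respˡ) <-trans

  ≤-antisym : ∀ {x y} → x ≤ y → y ≤ x → x ≈ y
  ≤-antisym = mk-antisym isEquivalence <-trans <-irrefl

  ≤-total : ∀ x y → x ≤ y ⊎ y ≤ x
  ≤-total = mk-total compare

  ≤-respʳ : ∀ {x y z} → y ≈ z → x ≤ y → x ≤ z
  ≤-respʳ y≈z x≤y = ≤-trans x≤y (inj₂ y≈z)

  <⇒≱ : ∀ {x y} → x < y → ¬ (y ≤ x)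
  <⇒≱ x<y (inj₁ y<x) = <-irrefl refl (<-trans x<y y<x)
  <⇒≱ x<y (inj₂ y≈x) = <-irrefl (sym y≈x) x<y

  ≮⇒≥ : ∀ {x y} → ¬ (x < y) → y ≤ x
  ≮⇒≥ {x} {y} x≮y with compare x y
  ... | tri< x<y _ _   = ⊥-elim (x≮y x<y)
  ... | tri≈ _ x≈y _   = inj₂ (sym x≈y)
  ... | tri> _ _ y<x   = inj₁ y<x

  0<⇒≉0 : ∀ {x} → 0# < x → x ≉ 0#
  0<⇒≉0 0<x x≈0 = <-irrefl (sym x≈0) 0<x

  0≤∧≉0⇒0< : ∀ {x} → 0# ≤ x → x ≉ 0# → 0# < x
  0≤∧≉0⇒0< (inj₁ 0<x) _   = 0<x
  0≤∧≉0⇒0< (inj₂ 0≈x) x≉0 = ⊥-elim (x≉0 (sym 0≈x))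

  x<y⇒0<y-x : ∀ {x y} → x < y → 0# < y - x
  x<y⇒0<y-x {x} {y} x<y = <-respˡ (-‿inverseˡ x) (<-respʳ (+-comm (- x) y) (+-monoʳ-< (- x) x<y))

  0<y-x⇒x<y : ∀ {x y} → 0# < y - x → x < y
  0<y-x⇒x<y {x} {y} 0<y-x = <-respˡ (+-identityʳ x)
    (<-respʳ (solve 2 (λ x y → x :+ (y :- x) := y) refl x y) (+-monoʳ-< x 0<y-x))

  x≤y⇒0≤y-x : ∀ {x y} → x ≤ y → 0# ≤ y - x
  x≤y⇒0≤y-x     (inj₁ x<y) = inj₁ (x<y⇒0<y-x x<y)
  x≤y⇒0≤y-x {x} (inj₂ x≈y) = inj₂ (trans (sym (-‿inverseʳ x)) (+-congʳ x≈y))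

  0≤y-x⇒x≤y : ∀ {x y} → 0# ≤ y - x → x ≤ y
  0≤y-x⇒x≤y         (inj₁ 0<y-x) = inj₁ (0<y-x⇒x<y 0<y-x)
  0≤y-x⇒x≤y {x} {y} (inj₂ 0≈y-x) = inj₂
    (trans (sym (+-identityʳ x)) (trans (+-congˡ 0≈y-x) (solve 2 (λ x y → x :+ (y :- x) := y) refl x y)))

  x<0⇒0<-x : ∀ {x} → x < 0# → 0# < - x
  x<0⇒0<-x x<0 = <-respʳ (+-identityˡ _) (x<y⇒0<y-x x<0)

  x≤0⇒0≤-x : ∀ {x} → x ≤ 0# → 0# ≤ - x
  x≤0⇒0≤-x x≤0 = ≤-respʳ (+-identityˡ _) (x≤y⇒0≤y-x x≤0)

  0<-x⇒x<0 : ∀ {x} → 0# < - x → x < 0#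
  0<-x⇒x<0 0<-x = 0<y-x⇒x<y (<-respʳ (sym (+-identityˡ _)) 0<-x)

  0≤-x⇒x≤0 : ∀ {x} → 0# ≤ - x → x ≤ 0#
  0≤-x⇒x≤0 0≤-x = 0≤y-x⇒x≤y (≤-respʳ (sym (+-identityˡ _)) 0≤-x)

  +-mono-≤ : ∀ {w x y z} → w ≤ x → y ≤ z → w + y ≤ x + z
  +-mono-≤ {w} {x} {y} {z} w≤x y≤z = ≤-trans
    (shift y w≤x)
    (≤-trans (inj₂ (+-comm x y)) (≤-trans (shift x y≤z) (inj₂ (+-comm z x))))
    where
    shift : ∀ a {x y} → x ≤ y → x + a ≤ y + a
    shift a (inj₁ x<y) = inj₁ (<-respˡ (+-comm a _) (<-respʳ (+-comm a _) (+-monoʳ-< a x<y)))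
    shift a (inj₂ x≈y) = inj₂ (+-congʳ x≈y)

  0≤x+y : ∀ {x y} → 0# ≤ x → 0# ≤ y → 0# ≤ x + y
  0≤x+y 0≤x 0≤y = ≤-trans (inj₂ (sym (+-identityˡ 0#))) (+-mono-≤ 0≤x 0≤y)

  0<x+y : ∀ {x y} → 0# < x → 0# ≤ y → 0# < x + y
  0<x+y {x} 0<x (inj₁ 0<y) = <-trans 0<x (<-respˡ (+-identityʳ x) (+-monoʳ-< x 0<y))
  0<x+y {x} 0<x (inj₂ 0≈y) = <-respʳ (trans (sym (+-identityʳ x)) (+-congˡ 0≈y)) 0<x

  0≤x*y : ∀ {x y} → 0# ≤ x → 0# ≤ y → 0# ≤ x * y
  0≤x*y (inj₁ 0<x) (inj₁ 0<y) = inj₁ (*-positive 0<x 0<y)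
  0≤x*y {x} 0≤x (inj₂ 0≈y)    = inj₂ (trans (sym (zeroʳ x)) (*-congˡ 0≈y))
  0≤x*y {x} {y} (inj₂ 0≈x) _  = inj₂ (trans (sym (zeroˡ y)) (*-congʳ 0≈x))

  0≤x*x : ∀ x → 0# ≤ x * x
  0≤x*x x with ≤-total 0# x
  ... | inj₁ 0≤x = 0≤x*y 0≤x 0≤x
  ... | inj₂ x≤0 = ≤-respʳ (solve 1 (λ x → (:- x) :* (:- x) := x :* x) refl x)
                     (0≤x*y (x≤0⇒0≤-x x≤0) (x≤0⇒0≤-x x≤0))

  *-monoˡ-≤ : ∀ {a x y} → 0# ≤ a → x ≤ y → a * x ≤ a * y
  *-monoˡ-≤ {a} {x} {y} 0≤a x≤y = 0≤y-x⇒x≤y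
    (≤-respʳ (solve 3 (λ a x y → a :* (y :- x) := a :* y :- a :* x) refl a x y)
      (0≤x*y 0≤a (x≤y⇒0≤y-x x≤y)))

  *-cancelˡ-0≤ : ∀ {a x} → 0# < a → 0# ≤ a * x → 0# ≤ x
  *-cancelˡ-0≤ {a} {x} 0<a 0≤ax with ≤-total 0# x
  ... | inj₁ 0≤x        = 0≤x
  ... | inj₂ (inj₂ x≈0) = inj₂ (sym x≈0)
  ... | inj₂ (inj₁ x<0) = ⊥-elim (<⇒≱ (*-positive 0<a (x<0⇒0<-x x<0))
    (0≤-x⇒x≤0 (≤-respʳ (solve 2 (λ a x → a :* x := :- (a :* :- x)) refl a x) 0≤ax)))

  *-cancelˡ-≤ : ∀ {a x y} → 0# < a → a * x ≤ a * y → x ≤ y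
  *-cancelˡ-≤ {a} {x} {y} 0<a ax≤ay = 0≤y-x⇒x≤y (*-cancelˡ-0≤ 0<a
    (≤-respʳ (solve 3 (λ a x y → a :* y :- a :* x := a :* (y :- x)) refl a x y) (x≤y⇒0≤y-x ax≤ay)))

  *-inverseˡ : ∀ x → x ≉ 0# → x ⁻¹ * x ≈ 1#
  *-inverseˡ x x≉0 = trans (*-comm _ _) (*-inverseʳ x x≉0)

  *-cancelˡ : ∀ {a x y} → a ≉ 0# → a * x ≈ a * y → x ≈ y
  *-cancelˡ {a} {x} {y} a≉0 ax≈ay = trans (sym (unscale x)) (trans (*-congˡ ax≈ay) (unscale y))
    where
    unscale : ∀ z → a ⁻¹ * (a * z) ≈ z
    unscale z = trans (sym (*-assoc _ _ _)) (trans (*-congʳ (*-inverseˡ a a≉0)) (*-identityˡ z))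

  a*x≈0⇒x≈0 : ∀ {a x} → a ≉ 0# → a * x ≈ 0# → x ≈ 0#
  a*x≈0⇒x≈0 {a} a≉0 ax≈0 = *-cancelˡ a≉0 (trans ax≈0 (sym (zeroʳ a)))

  a*x≉0 : ∀ {a x} → a ≉ 0# → x ≉ 0# → a * x ≉ 0#
  a*x≉0 a≉0 x≉0 ax≈0 = x≉0 (a*x≈0⇒x≈0 a≉0 ax≈0)

  x*x≈0⇒x≈0 : ∀ {x} → x * x ≈ 0# → x ≈ 0#
  x*x≈0⇒x≈0 {x} xx≈0 with x ≟ 0#
  ... | yes x≈0 = x≈0
  ... | no  x≉0 = a*x≈0⇒x≈0 x≉0 xx≈0

  0<x⁻¹ : ∀ {x} → 0# < x → 0# < x ⁻¹
  0<x⁻¹ {x} 0<x = 0≤∧≉0⇒0< (*-cancelˡ-0≤ 0<x (inj₁ (<-respʳ (sym (*-inverseʳ x x≉0)) 0<1)))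
    (λ x⁻¹≈0 → 0<⇒≉0 0<1 (trans (sym (*-inverseʳ x x≉0)) (trans (*-congˡ x⁻¹≈0) (zeroʳ x))))
    where x≉0 = 0<⇒≉0 0<x

  ∑-neg : ∀ {n} (f : Fin n → Carrier) → sum (λ i → - f i) ≈ - sum f
  ∑-neg {zero}  f = sym -0#≈0#
  ∑-neg {suc n} f = trans (+-congˡ (∑-neg (f ∘ suc)))
    (solve 2 (λ x y → (:- x) :+ (:- y) := :- (x :+ y)) refl _ _)

  ∑-distrib-- : ∀ {n} (f g : Fin n → Carrier) → sum (λ i → f i - g i) ≈ sum f - sum g
  ∑-distrib-- f g = trans (∑-distrib-+ f (λ i → - g i)) (+-congˡ (∑-neg g))

  ∑-zero : ∀ {n} {f : Fin n → Carrier} → (∀ i → f i ≈ 0#) → sum f ≈ 0#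
  ∑-zero {n} f≈0 = trans (sum-cong-≋ f≈0) (sum-replicate-zero n)

  ∑-mono-≤ : ∀ {n} {f g : Fin n → Carrier} → (∀ i → f i ≤ g i) → sum f ≤ sum g
  ∑-mono-≤ {zero}  f≤g = ≤-refl
  ∑-mono-≤ {suc n} f≤g = +-mono-≤ (f≤g zero) (∑-mono-≤ (f≤g ∘ suc))

  0≤∑ : ∀ {n} {f : Fin n → Carrier} → (∀ i → 0# ≤ f i) → 0# ≤ sum f
  0≤∑ {n} 0≤f = ≤-trans (inj₂ (sym (sum-replicate-zero n))) (∑-mono-≤ 0≤f)

  term≤∑ : ∀ {n} {f : Fin n → Carrier} → (∀ i → 0# ≤ f i) → ∀ i → f i ≤ sum f
  term≤∑ {suc n} {f} 0≤f i = begin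
    f i                             ≈⟨ +-identityʳ _ ⟨
    f i + 0#                        ≤⟨ +-mono-≤ ≤-refl (0≤∑ (λ j → 0≤f (punchIn i j))) ⟩
    f i + sum (f ∘ punchIn i)       ≈⟨ sum-remove f ⟨
    sum f                           ∎

  ∑≤0⇒≈0 : ∀ {n} {f : Fin n → Carrier} → (∀ i → 0# ≤ f i) → sum f ≤ 0# → ∀ i → f i ≈ 0#
  ∑≤0⇒≈0 0≤f ∑≤0 i = ≤-antisym (≤-trans (term≤∑ 0≤f i) ∑≤0) (0≤f i)

  ∑-single : ∀ {n} {f : Fin n → Carrier} i → (∀ j → ¬ (i ≡ j) → f j ≈ 0#) → sum f ≈ f i
  ∑-single {suc n} {f} i off = trans (sum-remove f)
    (trans (+-congˡ (∑-zero (λ j → off (punchIn i j) (λ i≡ → Fin.punchInᵢ≢i i j (≡.sym i≡)))))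
      (+-identityʳ _))

-- Dot products, linear spans and Gaussian elimination.

module LinearAlgebra {c ℓ₁ ℓ₂ : Level} (ℝ : Reals c ℓ₁ ℓ₂) where

  open RealArithmetic ℝ

  infix 7 _∙_
  _∙_ : ∀ {n} → Vector Carrier n → Vector Carrier n → Carrier
  u ∙ v = sum λ i → u i * v i

  NonZero : ∀ {n} → Vector Carrier n → Set ℓ₁
  NonZero v = ∃ λ i → v i ≉ 0#

  ∙-cong : ∀ {n} {u u′ v v′ : Vector Carrier n} →
           (∀ i → u i ≈ u′ i) → (∀ i → v i ≈ v′ i) → u ∙ v ≈ u′ ∙ v′
  ∙-cong u≈ v≈ = sum-cong-≋ (λ i → *-cong (u≈ i) (v≈ i))

  ∙-comm : ∀ {n} (u v : Vector Carrier n) → u ∙ v ≈ v ∙ u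
  ∙-comm u v = sum-cong-≋ (λ i → *-comm (u i) (v i))

  ∙-distribˡ-+ : ∀ {n} (u v w : Vector Carrier n) → u ∙ (λ i → v i + w i) ≈ u ∙ v + u ∙ w
  ∙-distribˡ-+ u v w = trans (sum-cong-≋ (λ i → distribˡ (u i) (v i) (w i)))
    (∑-distrib-+ (λ i → u i * v i) (λ i → u i * w i))

  ∙-distribˡ-- : ∀ {n} (u v w : Vector Carrier n) → u ∙ (λ i → v i - w i) ≈ u ∙ v - u ∙ w
  ∙-distribˡ-- u v w = trans
    (sum-cong-≋ (λ i → solve 3 (λ u v w → u :* (v :- w) := u :* v :- u :* w) refl (u i) (v i) (w i)))
    (∑-distrib-- (λ i → u i * v i) (λ i → u i * w i))

  ∙-scaleʳ : ∀ {n} a (u v : Vector Carrier n) → u ∙ (λ i → a * v i) ≈ a * (u ∙ v)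
  ∙-scaleʳ a u v = trans
    (sum-cong-≋ (λ i → solve 3 (λ a u v → u :* (a :* v) := a :* (u :* v)) refl a (u i) (v i)))
    (sym (*-distribˡ-sum a (λ i → u i * v i)))

  ∙-∑ʳ : ∀ {m n} (u : Vector Carrier n) (f : Fin m → Vector Carrier n) →
         u ∙ (λ j → sum λ i → f i j) ≈ sum (λ i → u ∙ f i)
  ∙-∑ʳ u f = trans (sum-cong-≋ (λ j → *-distribˡ-sum (u j) (λ i → f i j)))
    (∑-comm (λ j i → u j * f i j))

  ∙-zeroʳ : ∀ {n} (u : Vector Carrier n) {v} → (∀ i → v i ≈ 0#) → u ∙ v ≈ 0#
  ∙-zeroʳ u v≈0 = ∑-zero (λ i → trans (*-congˡ (v≈0 i)) (zeroʳ (u i)))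

  0≤v∙v : ∀ {n} (v : Vector Carrier n) → 0# ≤ v ∙ v
  0≤v∙v v = 0≤∑ (λ i → 0≤x*x (v i))

  0<v∙v : ∀ {n} {v : Vector Carrier n} → NonZero v → 0# < v ∙ v
  0<v∙v {v = v} (i , vᵢ≉0) = 0≤∧≉0⇒0< (0≤v∙v v) λ v∙v≈0 →
    vᵢ≉0 (x*x≈0⇒x≈0 (∑≤0⇒≈0 (λ j → 0≤x*x (v j)) (inj₂ v∙v≈0) i))

  -- An inductive family instead of a coefficient vector: elimination can assemble derivations
  -- without ever naming an inverse matrix, and estimates follow by recursion on them. `resp` is a
  -- constructor because functions are compared only pointwise.
  data Span {a} {X : Set a} {k} (g : Fin k → X → Carrier) :
            (X → Carrier) → Set (a ⊔ c ⊔ ℓ₁) where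
    generator : ∀ i → Span g (g i)
    zero      : Span g (λ _ → 0#)
    _⊕_       : ∀ {φ ψ} → Span g φ → Span g ψ → Span g (λ x → φ x + ψ x)
    scale     : ∀ a {φ} → Span g φ → Span g (λ x → a * φ x)
    resp      : ∀ {φ ψ} → (∀ x → φ x ≈ ψ x) → Span g φ → Span g ψ

  module _ {a} {X : Set a} where

    span-∑ : ∀ {k m} {g : Fin k → X → Carrier} {φ : Fin m → X → Carrier} →
             (∀ i → Span g (φ i)) → Span g (λ x → sum λ i → φ i x)
    span-∑ {m = zero}  _  = zero
    span-∑ {m = suc m} gs = gs zero ⊕ span-∑ (gs ∘ suc)

    span-pullback : ∀ {b} {Y : Set b} {k l} {g : Fin k → X → Carrier} {h : Fin l → Y → Carrier} {φ}
                    (f : Y → X) → (∀ i → Span h (g i ∘ f)) → Span g φ → Span h (φ ∘ f)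
    span-pullback f gs (generator i) = gs i
    span-pullback f gs zero          = zero
    span-pullback f gs (s ⊕ t)       = span-pullback f gs s ⊕ span-pullback f gs t
    span-pullback f gs (scale a s)   = scale a (span-pullback f gs s)
    span-pullback f gs (resp φ≈ψ s)  = resp (φ≈ψ ∘ f) (span-pullback f gs s)

    abstract
      -- The constant is computed along the derivation. A sum costs a factor 2, since (a + b)² + (a
      -- - b)² = 2 (a² + b²) and the second square is nonnegative; a scalar costs its square.
      span-bound : ∀ {k} {g : Fin k → X → Carrier} {φ} → Span g φ →
                   ∃ λ C → 0# ≤ C × (∀ x → φ x * φ x ≤ C * sum (λ i → g i x * g i x))
      span-bound {g = g} (generator i) = 1# , inj₁ 0<1 , λ x →
        ≤-trans (term≤∑ (λ j → 0≤x*x (g j x)) i) (inj₂ (sym (*-identityˡ _)))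
      span-bound zero = 0# , ≤-refl , λ x → inj₂ (trans (zeroˡ 0#) (sym (zeroˡ _)))
      span-bound {g = g} (_⊕_ {φ} {ψ} s t) with span-bound s | span-bound t
      ... | C , 0≤C , φ≤ | D , 0≤D , ψ≤ =
        2# * (C + D) , 0≤x*y 0≤2 (0≤x+y 0≤C 0≤D) , λ x → begin
          (φ x + ψ x) * (φ x + ψ x)
            ≈⟨ +-identityʳ _ ⟨
          (φ x + ψ x) * (φ x + ψ x) + 0#
            ≤⟨ +-mono-≤ ≤-refl (0≤x*x (φ x - ψ x)) ⟩
          (φ x + ψ x) * (φ x + ψ x) + (φ x - ψ x) * (φ x - ψ x)
            ≈⟨ solve 2 (λ a b → (a :+ b) :* (a :+ b) :+ (a :- b) :* (a :- b)
                          := (con (ℤ.+ 2)) :* (a :* a :+ b :* b)) refl (φ x) (ψ x) ⟩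
          2# * (φ x * φ x + ψ x * ψ x)
            ≤⟨ *-monoˡ-≤ 0≤2 (+-mono-≤ (φ≤ x) (ψ≤ x)) ⟩
          2# * (C * Q x + D * Q x)
            ≈⟨ solve 4 (λ k a b q → k :* (a :* q :+ b :* q) := k :* (a :+ b) :* q) refl 2# C D (Q x) ⟩
          2# * (C + D) * Q x ∎
        where
        Q : X → Carrier
        Q x = sum (λ i → g i x * g i x)
        0≤2 : 0# ≤ 2#
        0≤2 = 0≤x+y (inj₁ 0<1) (inj₁ 0<1)
      span-bound {g = g} (scale a {φ} s) with span-bound s
      ... | C , 0≤C , φ≤ = a * a * C , 0≤x*y (0≤x*x a) 0≤C , λ x → begin
        a * φ x * (a * φ x)    ≈⟨ solve 2 (λ a b → a :* b :* (a :* b) := a :* a :* (b :* b)) refl a (φ x) ⟩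
        a * a * (φ x * φ x)    ≤⟨ *-monoˡ-≤ (0≤x*x a) (φ≤ x) ⟩
        a * a * (C * sum (λ i → g i x * g i x))    ≈⟨ *-assoc _ _ _ ⟨
        a * a * C * sum (λ i → g i x * g i x)      ∎
      span-bound (resp φ≈ψ s) with span-bound s
      ... | C , 0≤C , φ≤ = C , 0≤C , λ x →
        ≤-trans (inj₂ (*-cong (sym (φ≈ψ x)) (sym (φ≈ψ x)))) (φ≤ x)

      -- Here C is kept strictly positive, because it later enters an ε through its inverse; hence
      -- the value `1#` for the empty family.
      spans-bound : ∀ {k m} {g : Fin k → X → Carrier} {φ : Fin m → X → Carrier} → (∀ i → Span g (φ i)) →
                    ∃ λ C → 0# < C × (∀ x → sum (λ i → φ i x * φ i x) ≤ C * sum (λ i → g i x * g i x))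
      spans-bound {m = zero} {g} _ = 1# , 0<1 , λ x →
        ≤-respʳ (sym (*-identityˡ _)) (0≤∑ (λ i → 0≤x*x (g i x)))
      spans-bound {m = suc m} gs with span-bound (gs zero) | spans-bound (gs ∘ suc)
      ... | C , 0≤C , φ≤ | D , 0<D , ∑φ≤ = D + C , 0<x+y 0<D 0≤C , λ x →
        ≤-trans (+-mono-≤ (φ≤ x) (∑φ≤ x)) (inj₂ (trans (+-comm _ _) (sym (distribʳ _ D C))))

  dot-span : ∀ {n} (u : Vector Carrier n) → Span (λ i w → w i) (λ w → u ∙ w)
  dot-span u = span-∑ (λ i → scale (u i) (generator i))

  Kernel : ∀ {k n} → Vector (Vector Carrier n) k → Set (c ⊔ ℓ₁)
  Kernel A = ∃ λ w → NonZero w × (∀ i → A i ∙ w ≈ 0#)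

  -- A left inverse of A in disguise. Through `spans-bound` it is also the quantitative form of
  -- injectivity.
  SpansCoordinates : ∀ {k n} → Vector (Vector Carrier n) k → Set (c ⊔ ℓ₁)
  SpansCoordinates A = ∀ j → Span (λ i w → A i ∙ w) (λ w → w j)

  module Elimination {k n} (A : Vector (Vector Carrier (suc n)) (suc k)) (p : Fin (suc k))
                     (pivot≉0 : A p zero ≉ 0#) where
    pivot = A p zero

    factor : Fin k → Carrier
    factor i = A (punchIn p i) zero * pivot ⁻¹

    -- The Schur complement of the pivot. `punchIn p` enumerates the other rows, so that no rows
    -- have to be exchanged.
    reduced : Vector (Vector Carrier n) k
    reduced i j = A (punchIn p i) (suc j) - factor i * A p (suc j)

    reduced-∙ : ∀ i w → reduced i ∙ tail w ≈ A (punchIn p i) ∙ w - factor i * (A p ∙ w)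
    reduced-∙ i w = begin-equality
      reduced i ∙ tail w
        ≈⟨ ∙-comm (reduced i) (tail w) ⟩
      tail w ∙ reduced i
        ≈⟨ ∙-distribˡ-- (tail w) (tail a) (λ j → factor i * A p (suc j)) ⟩
      tail w ∙ tail a - tail w ∙ (λ j → factor i * A p (suc j))
        ≈⟨ +-cong (∙-comm (tail w) (tail a)) (-‿cong (trans (∙-scaleʳ (factor i) (tail w) (tail (A p)))
             (*-congˡ (∙-comm (tail w) (tail (A p)))))) ⟩
      T - factor i * S
        ≈⟨ solve 5 (λ f b s t w₀ → t :- f :* s := f :* b :* w₀ :+ t :- f :* (b :* w₀ :+ s)) refl
             (factor i) pivot S T (w zero) ⟩
      factor i * pivot * w zero + T - factor i * (A p ∙ w)
        ≈⟨ +-congʳ (+-congʳ (*-congʳ (trans (*-assoc _ _ _)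
             (trans (*-congˡ (*-inverseˡ pivot pivot≉0)) (*-identityʳ _))))) ⟩
      a ∙ w - factor i * (A p ∙ w) ∎
      where
      a = A (punchIn p i)
      T = tail a ∙ tail w
      S = tail (A p) ∙ tail w

    kernel : Kernel reduced → Kernel A
    kernel (w′ , (j , w′ⱼ≉0) , reduced≈0) = w , (suc j , w′ⱼ≉0) , A∙w≈0
      where
      S = tail (A p) ∙ w′
      -- Back substitution: the head is the value that the pivot row prescribes.
      w = - (pivot ⁻¹ * S) ◂ w′
      pivotRow : A p ∙ w ≈ 0#
      pivotRow = begin-equality
        pivot * - (pivot ⁻¹ * S) + S   ≈⟨ solve 3 (λ b b⁻¹ s → b :* :- (b⁻¹ :* s) :+ s
                                            := s :- b :* b⁻¹ :* s) refl pivot (pivot ⁻¹) S ⟩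
        S - pivot * pivot ⁻¹ * S       ≈⟨ +-congˡ (-‿cong (trans (*-congʳ (*-inverseʳ pivot pivot≉0))
                                            (*-identityˡ S))) ⟩
        S - S                          ≈⟨ -‿inverseʳ S ⟩
        0#                             ∎
      otherRow : ∀ i → A (punchIn p i) ∙ w ≈ 0#
      otherRow i = begin-equality
        A (punchIn p i) ∙ w
          ≈⟨ solve 3 (λ a f b → a := (a :- f :* b) :+ f :* b) refl _ (factor i) (A p ∙ w) ⟩
        (A (punchIn p i) ∙ w - factor i * (A p ∙ w)) + factor i * (A p ∙ w)
          ≈⟨ +-cong (trans (sym (reduced-∙ i w)) (reduced≈0 i)) (trans (*-congˡ pivotRow) (zeroʳ _)) ⟩
        0# + 0#
          ≈⟨ +-identityˡ 0# ⟩
        0# ∎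
      A∙w≈0 : ∀ i → A i ∙ w ≈ 0#
      A∙w≈0 i with p Fin.≟ i
      ... | yes ≡.refl = pivotRow
      ... | no  p≢i    = ≡.subst (λ i → A i ∙ w ≈ 0#) (Fin.punchIn-punchOut p≢i) (otherRow (punchOut p≢i))

    coordinates : SpansCoordinates reduced → SpansCoordinates A
    coordinates spans = λ where
        zero    → resp solveHead (scale (pivot ⁻¹) (generator p ⊕ scale (- 1#)
                    (span-∑ {g = λ i w → A i ∙ w} (λ j → scale (A p (suc j)) (tailSpan j)))))
        (suc j) → tailSpan j
      where
      tailSpan : ∀ j → Span (λ i w → A i ∙ w) (λ w → w (suc j))
      tailSpan j = span-pullback tail
        (λ i → resp (λ w → trans (solve 3 (λ a f b → a :+ (:- f) :* b := a :- f :* b) refl _ (factor i) _)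
                             (sym (reduced-∙ i w)))
          (generator (punchIn p i) ⊕ scale (- factor i) (generator p)))
        (spans j)
      solveHead : ∀ w → pivot ⁻¹ * (A p ∙ w + - 1# * (tail (A p) ∙ tail w)) ≈ w zero
      solveHead w = begin-equality
        pivot ⁻¹ * (A p ∙ w + - 1# * S)
          ≈⟨ solve 4 (λ b⁻¹ b w₀ s → b⁻¹ :* (b :* w₀ :+ s :+ (:- con (ℤ.+ 1)) :* s) := b⁻¹ :* b :* w₀) refl
               (pivot ⁻¹) pivot (w zero) S ⟩
        pivot ⁻¹ * pivot * w zero
          ≈⟨ trans (*-congʳ (*-inverseˡ pivot pivot≉0)) (*-identityˡ _) ⟩
        w zero ∎
        where S = tail (A p) ∙ tail w

  zeroColumn⇒kernel : ∀ {k n} (A : Vector (Vector Carrier (suc n)) k) → (∀ i → A i zero ≈ 0#) → Kernel A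
  zeroColumn⇒kernel A A₀≈0 = 1# ◂ (λ _ → 0#) , (zero , 0<⇒≉0 0<1) , λ i →
    trans (+-cong (trans (*-identityʳ _) (A₀≈0 i)) (∙-zeroʳ (tail (A i)) (λ _ → refl))) (+-identityˡ 0#)

  abstract
    -- Recursion on the rows and columns: a first column of zeros gives a kernel vector at once, any
    -- other supplies a pivot. In the second alternative, n ≤ k serves the dimension counts and the
    -- span serves the estimates of the spectral theorem.
    eliminate : ∀ {k n} (A : Vector (Vector Carrier n) k) → Kernel A ⊎ (n ℕ.≤ k × SpansCoordinates A)
    eliminate         {n = zero}  A = inj₂ (z≤n , λ ())
    eliminate {zero}  {n = suc n} A = inj₁ (zeroColumn⇒kernel A (λ ()))
    eliminate {suc k} {n = suc n} A with Fin.any? (λ i → ¬? (A i zero ≟ 0#))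
    ... | no  none = inj₁ (zeroColumn⇒kernel A λ i →
            decidable-stable (A i zero ≟ 0#) (λ Aᵢ≉0 → none (i , Aᵢ≉0)))
    ... | yes (p , pivot≉0) with eliminate (Elimination.reduced A p pivot≉0)
    ...   | inj₁ ker           = inj₁ (Elimination.kernel A p pivot≉0 ker)
    ...   | inj₂ (n≤k , spans) = inj₂ (s≤s n≤k , Elimination.coordinates A p pivot≉0 spans)

-- The spectral theorem for symmetric matrices.

module Spectral {c ℓ₁ ℓ₂ : Level} (ℝ : Reals c ℓ₁ ℓ₂) where

  open RealArithmetic ℝ
  open LinearAlgebra ℝ

  infix 8 _*ᵥ_
  _*ᵥ_ : ∀ {m n} → Vector (Vector Carrier n) m → Vector Carrier n → Vector Carrier m
  (A *ᵥ w) i = A i ∙ w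

  Symmetric : ∀ {n} → Matrix ℝ n → Set ℓ₁
  Symmetric A = ∀ i j → A i j ≈ A j i

  scalarMatrix-diagonal : ∀ {n} x (i : Fin n) → scalarMatrix ℝ x i i ≈ x
  scalarMatrix-diagonal x i = reflexive (≡.cong (if_then x else 0#) (dec-true (i Fin.≟ i) ≡.refl))

  scalarMatrix-offDiagonal : ∀ {n} x {i j : Fin n} → ¬ (i ≡ j) → scalarMatrix ℝ x i j ≈ 0#
  scalarMatrix-offDiagonal x {i} {j} i≢j = reflexive (≡.cong (if_then x else 0#) (dec-false (i Fin.≟ j) i≢j))

  scalarMatrix-*ᵥ : ∀ {n} x (w : Vector Carrier n) i → (scalarMatrix ℝ x *ᵥ w) i ≈ x * w i
  scalarMatrix-*ᵥ x w i = trans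
    (∑-single i (λ j i≢j → trans (*-congʳ (scalarMatrix-offDiagonal x i≢j)) (zeroˡ _)))
    (*-congʳ (scalarMatrix-diagonal x i))

  selfAdjoint : ∀ {n} {A : Matrix ℝ n} → Symmetric A → ∀ u w → u ∙ (A *ᵥ w) ≈ (A *ᵥ u) ∙ w
  selfAdjoint {A = A} A-sym u w = begin-equality
    sum (λ i → u i * sum (λ j → A i j * w j))     ≈⟨ sum-cong-≋ (λ i → *-distribˡ-sum (u i) (λ j → A i j * w j)) ⟩
    sum (λ i → sum λ j → u i * (A i j * w j))     ≈⟨ ∑-comm (λ i j → u i * (A i j * w j)) ⟩
    sum (λ j → sum λ i → u i * (A i j * w j))     ≈⟨ sum-cong-≋ (λ j → sum-cong-≋ λ i → trans
                                                       (*-congˡ (*-congʳ (A-sym i j)))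
                                                       (solve 3 (λ u a w → u :* (a :* w) := a :* u :* w) refl
                                                         (u i) (A j i) (w j))) ⟩
    sum (λ j → sum λ i → A j i * u i * w j)       ≈⟨ sum-cong-≋ (λ j → *-distribʳ-sum (w j) (λ i → A j i * u i)) ⟨
    sum (λ j → sum (λ i → A j i * u i) * w j)     ∎

  -- A crude substitute for the Cauchy-Schwarz inequality that is free of square roots; only the
  -- existence of some bound matters.
  u∙v≤u∙u+v∙v : ∀ {n} (u v : Vector Carrier n) → u ∙ v ≤ u ∙ u + v ∙ v
  u∙v≤u∙u+v∙v u v = ≤-respʳ (∑-distrib-+ (λ i → u i * u i) (λ i → v i * v i)) (∑-mono-≤ λ i → pointwise (u i) (v i))
    where
    pointwise : ∀ a b → a * b ≤ a * a + b * b
    pointwise a b = 0≤y-x⇒x≤y (*-cancelˡ-0≤ (0<x+y 0<1 (inj₁ 0<1)) (≤-respʳ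
      (solve 2 (λ a b → (a :- b) :* (a :- b) :+ (a :* a :+ b :* b)
        := con (ℤ.+ 2) :* (a :* a :+ b :* b :- a :* b)) refl a b)
      (0≤x+y (0≤x*x (a - b)) (0≤x+y (0≤x*x a) (0≤x*x b)))))

  abstract
    form-bound : ∀ {n} (φ : Fin n → Vector Carrier n → Carrier) → (∀ i → Span (λ j w → w j) (φ i)) →
                 ∃ λ K → 0# < K × (∀ w → w ∙ (λ i → φ i w) ≤ K * (w ∙ w))
    form-bound φ spans with spans-bound spans
    ... | D , 0<D , bound = 1# + D , 0<x+y 0<1 (inj₁ 0<D) , λ w → begin
      w ∙ (λ i → φ i w)                          ≤⟨ u∙v≤u∙u+v∙v w (λ i → φ i w) ⟩
      w ∙ w + (λ i → φ i w) ∙ (λ i → φ i w)      ≤⟨ +-mono-≤ ≤-refl (bound w) ⟩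
      w ∙ w + D * (w ∙ w)                        ≈⟨ solve 2 (λ d q → q :+ d :* q := (con (ℤ.+ 1) :+ d) :* q) refl D (w ∙ w) ⟩
      (1# + D) * (w ∙ w)                         ∎

  record Eigenframe {n} (A : Matrix ℝ n) (k : ℕ) : Set (c ⊔ ℓ₁ ⊔ ℓ₂) where
    field
      vector     : Vector (Vector Carrier n) k
      value      : Vector Carrier k
      orthogonal : ∀ {i j} → ¬ (i ≡ j) → vector i ∙ vector j ≈ 0#
      nonZero    : ∀ i → 0# < vector i ∙ vector i
      eigen      : ∀ i j → (A *ᵥ vector i) j ≈ value i * vector i j

  module NextEigenvector {n k} {A : Matrix ℝ n} (A-sym : Symmetric A) (frame : Eigenframe A k) (k<n : k ℕ.< n) where
    open Eigenframe frame renaming (vector to v; value to μ)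

    Complement : Vector Carrier n → Set ℓ₁
    Complement w = ∀ i → v i ∙ w ≈ 0#

    -- The downward closure of the set of Rayleigh quotients on the complement, with the denominator
    -- multiplied out. It has the same upper bounds, and membership can be stated without division.
    RayleighLowerBound : Carrier → Set (c ⊔ ℓ₁ ⊔ ℓ₂)
    RayleighLowerBound x = ∃ λ w → Complement w × 0# < w ∙ w × x * (w ∙ w) ≤ w ∙ (A *ᵥ w)

    abstract
      -- The k orthogonality conditions in n > k unknowns have a nonzero solution, whose Rayleigh
      -- quotient belongs to the set.
      inhabited : ∃ RayleighLowerBound
      inhabited with eliminate v
      ... | inj₂ (n≤k , _)     = ⊥-elim (ℕ.<⇒≱ k<n n≤k)
      ... | inj₁ (w , w≉0 , w⊥v) = (w ∙ w) ⁻¹ * (w ∙ (A *ᵥ w)) , w , w⊥v , 0<w∙w , inj₂ (begin-equality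
        (w ∙ w) ⁻¹ * (w ∙ (A *ᵥ w)) * (w ∙ w)    ≈⟨ solve 3 (λ a b d → a :* b :* d := a :* d :* b) refl _ _ _ ⟩
        (w ∙ w) ⁻¹ * (w ∙ w) * (w ∙ (A *ᵥ w))    ≈⟨ *-congʳ (*-inverseˡ _ (0<⇒≉0 0<w∙w)) ⟩
        1# * (w ∙ (A *ᵥ w))                      ≈⟨ *-identityˡ _ ⟩
        w ∙ (A *ᵥ w)                             ∎)
        where
        0<w∙w : 0# < w ∙ w
        0<w∙w = 0<v∙v w≉0

      bounded : ∃ (UpperBound RayleighLowerBound)
      bounded = let K , _ , bound = form-bound (λ i w → (A *ᵥ w) i) (λ i → dot-span (A i)) in
        K , λ x (w , _ , 0<w∙w , x≤) → *-cancelˡ-≤ 0<w∙w (begin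
          (w ∙ w) * x      ≈⟨ *-comm (w ∙ w) x ⟩
          x * (w ∙ w)      ≤⟨ x≤ ⟩
          w ∙ (A *ᵥ w)     ≤⟨ bound w ⟩
          K * (w ∙ w)      ≈⟨ *-comm K (w ∙ w) ⟩
          (w ∙ w) * K      ∎)

    λ₁ : Carrier
    λ₁ = proj₁ (sup RayleighLowerBound inhabited bounded)

    λ₁-upper : UpperBound RayleighLowerBound λ₁
    λ₁-upper = proj₁ (proj₂ (sup RayleighLowerBound inhabited bounded))

    λ₁-least : ∀ u → UpperBound RayleighLowerBound u → λ₁ ≤ u
    λ₁-least = proj₂ (proj₂ (sup RayleighLowerBound inhabited bounded))

    B : Vector Carrier n → Vector Carrier n
    B w i = λ₁ * w i - (A *ᵥ w) i

    ∙-B : ∀ u w → u ∙ B w ≈ λ₁ * (u ∙ w) - u ∙ (A *ᵥ w)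
    ∙-B u w = trans (∙-distribˡ-- u (λ i → λ₁ * w i) (A *ᵥ w)) (+-congʳ (∙-scaleʳ λ₁ u w))

    B-selfAdjoint : ∀ u w → u ∙ B w ≈ B u ∙ w
    B-selfAdjoint u w = begin-equality
      u ∙ B w                        ≈⟨ ∙-B u w ⟩
      λ₁ * (u ∙ w) - u ∙ (A *ᵥ w)    ≈⟨ +-cong (*-congˡ (∙-comm u w))
                                          (-‿cong (trans (selfAdjoint A-sym u w) (∙-comm (A *ᵥ u) w))) ⟩
      λ₁ * (w ∙ u) - w ∙ (A *ᵥ u)    ≈⟨ ∙-B w u ⟨
      w ∙ B u                        ≈⟨ ∙-comm w (B u) ⟩
      B u ∙ w                        ∎

    v∙Aw : ∀ i w → v i ∙ (A *ᵥ w) ≈ μ i * (v i ∙ w)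
    v∙Aw i w = begin-equality
      v i ∙ (A *ᵥ w)               ≈⟨ selfAdjoint A-sym (v i) w ⟩
      (A *ᵥ v i) ∙ w               ≈⟨ ∙-comm (A *ᵥ v i) w ⟩
      w ∙ (A *ᵥ v i)               ≈⟨ ∙-cong {u = w} (λ _ → refl) (eigen i) ⟩
      w ∙ (λ j → μ i * v i j)      ≈⟨ ∙-scaleʳ (μ i) w (v i) ⟩
      μ i * (w ∙ v i)              ≈⟨ *-congˡ (∙-comm w (v i)) ⟩
      μ i * (v i ∙ w)              ∎

    v∙Bw : ∀ i w → v i ∙ B w ≈ (λ₁ - μ i) * (v i ∙ w)
    v∙Bw i w = trans (∙-B (v i) w) (trans (+-congˡ (-‿cong (v∙Aw i w)))
      (solve 3 (λ l m q → l :* q :- m :* q := (l :- m) :* q) refl λ₁ (μ i) (v i ∙ w)))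

    B-complement : ∀ {w} → Complement w → Complement (B w)
    B-complement {w} w⊥v i = trans (v∙Bw i w) (trans (*-congˡ (w⊥v i)) (zeroʳ _))

    B-linear : ∀ a u w i → B (λ j → a * u j - w j) i ≈ a * B u i - B w i
    B-linear a u w i = trans
      (+-congˡ (-‿cong (trans (∙-distribˡ-- (A i) (λ j → a * u j) w) (+-congʳ (∙-scaleʳ a (A i) u)))))
      (solve 6 (λ l a x y p q → l :* (a :* x :- y) :- (a :* p :- q) := a :* (l :* x :- p) :- (l :* y :- q))
        refl λ₁ a (u i) (w i) (A i ∙ u) (A i ∙ w))

    B-semidefinite : ∀ {w} → Complement w → 0# ≤ w ∙ B w
    B-semidefinite {w} w⊥v with 0≤v∙v w
    ... | inj₂ 0≈w∙w = inj₂ (sym (trans (∙-comm w (B w)) (∙-zeroʳ (B w) λ i →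
            x*x≈0⇒x≈0 (∑≤0⇒≈0 (λ j → 0≤x*x (w j)) (inj₂ (sym 0≈w∙w)) i))))
    ... | inj₁ 0<w∙w = ≤-respʳ (sym (∙-B w w)) (x≤y⇒0≤y-x (begin
      w ∙ (A *ᵥ w)                      ≈⟨ *-identityˡ _ ⟨
      1# * (w ∙ (A *ᵥ w))               ≈⟨ *-congʳ (*-inverseʳ _ (0<⇒≉0 0<w∙w)) ⟨
      (w ∙ w) * (w ∙ w) ⁻¹ * (w ∙ (A *ᵥ w))  ≈⟨ *-assoc _ _ _ ⟩
      (w ∙ w) * ρ                       ≤⟨ *-monoˡ-≤ (inj₁ 0<w∙w) (λ₁-upper ρ (w , w⊥v , 0<w∙w , inj₂ ρ-attained)) ⟩
      (w ∙ w) * λ₁                      ≈⟨ *-comm _ _ ⟩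
      λ₁ * (w ∙ w)                      ∎))
      where
      ρ = (w ∙ w) ⁻¹ * (w ∙ (A *ᵥ w))
      ρ-attained : ρ * (w ∙ w) ≈ w ∙ (A *ᵥ w)
      ρ-attained = trans (*-comm _ _) (trans (sym (*-assoc _ _ _))
        (trans (*-congʳ (*-inverseʳ _ (0<⇒≉0 0<w∙w))) (*-identityˡ _)))

    abstract
      B-bound : ∃ λ K → 0# < K × (∀ w → w ∙ B w ≤ K * (w ∙ w))
      B-bound = form-bound (λ i w → B w i) λ i → resp (λ w → +-congˡ (solve 1 (λ x → (:- con (ℤ.+ 1)) :* x := :- x) refl (A i ∙ w)))
        (scale λ₁ (generator i) ⊕ scale (- 1#) (dot-span (A i)))

      -- Evaluate the semidefinite form of B at K w - B w.
      B-norm : ∃ λ K → 0# < K × (∀ {w} → Complement w → B w ∙ B w ≤ K * (w ∙ B w))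
      B-norm = let K , 0<K , bound = B-bound in K , 0<K , λ {w} w⊥v →
        let y = B w
            z = λ i → K * w i - y i
            z⊥v : Complement z
            z⊥v i = trans (∙-distribˡ-- (v i) (λ j → K * w j) y) (trans
              (+-cong (trans (∙-scaleʳ K (v i) w) (trans (*-congˡ (w⊥v i)) (zeroʳ K))) (-‿cong (B-complement w⊥v i)))
              (-‿inverseʳ 0#))
            z∙ : ∀ u → z ∙ u ≈ K * (w ∙ u) - y ∙ u
            z∙ u = trans (∙-comm z u) (trans (∙-distribˡ-- u (λ j → K * w j) y)
              (+-cong (trans (∙-scaleʳ K u w) (*-congˡ (∙-comm u w))) (-‿cong (∙-comm u y))))
        in 0≤y-x⇒x≤y (*-cancelˡ-0≤ 0<K (begin
          0#                                              ≤⟨ B-semidefinite z⊥v ⟩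
          z ∙ B z                                         ≈⟨ ∙-cong {u = z} (λ _ → refl) (B-linear K w y) ⟩
          z ∙ (λ i → K * y i - B y i)                     ≈⟨ ∙-distribˡ-- z (λ i → K * y i) (B y) ⟩
          z ∙ (λ i → K * y i) - z ∙ B y                   ≈⟨ +-congʳ (∙-scaleʳ K z y) ⟩
          K * (z ∙ y) - z ∙ B y                           ≈⟨ +-cong (*-congˡ (z∙ y)) (-‿cong (z∙ (B y))) ⟩
          K * (K * (w ∙ y) - y ∙ y) - (K * (w ∙ B y) - y ∙ B y)
            ≈⟨ +-congˡ (-‿cong (+-congʳ (*-congˡ (B-selfAdjoint w y)))) ⟩
          K * (K * (w ∙ y) - y ∙ y) - (K * (y ∙ y) - y ∙ B y)
            ≈⟨ solve 4 (λ k q r s → k :* (k :* q :- r) :- (k :* r :- s) := k :* (k :* q :- r) :- k :* r :+ s)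
                 refl K (w ∙ y) (y ∙ y) (y ∙ B y) ⟩
          K * (K * (w ∙ y) - y ∙ y) - K * (y ∙ y) + y ∙ B y
            ≤⟨ +-mono-≤ ≤-refl (bound y) ⟩
          K * (K * (w ∙ y) - y ∙ y) - K * (y ∙ y) + K * (y ∙ y)
            ≈⟨ solve 2 (λ a b → a :- b :+ b := a) refl _ _ ⟩
          K * (K * (w ∙ y) - y ∙ y)                       ∎))

    -- On `v l` the operator `B` acts as λ₁ - μ l. The numerator is what is missing to 1, and the
    -- denominator compensates for `v l` not being normalised.
    shift : Fin k → Carrier
    shift l = (v l ∙ v l) ⁻¹ * (1# - λ₁ + μ l)

    -- λ₁I - A, changed on the span of the eigenvectors already found so as to fix each of them.
    B′ : Matrix ℝ n
    B′ i j = scalarMatrix ℝ λ₁ i j - A i j + sum λ l → shift l * v l i * v l j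

    B′-*ᵥ : ∀ w i → (B′ *ᵥ w) i ≈ B w i + sum λ l → shift l * (v l ∙ w) * v l i
    B′-*ᵥ w i = begin-equality
      B′ i ∙ w
        ≈⟨ ∙-comm (B′ i) w ⟩
      w ∙ B′ i
        ≈⟨ ∙-distribˡ-+ w (λ j → scalarMatrix ℝ λ₁ i j - A i j) (λ j → sum λ l → shift l * v l i * v l j) ⟩
      w ∙ (λ j → scalarMatrix ℝ λ₁ i j - A i j) + w ∙ (λ j → sum λ l → shift l * v l i * v l j)
        ≈⟨ +-cong
             (trans (∙-distribˡ-- w (scalarMatrix ℝ λ₁ i) (A i))
               (+-cong (trans (∙-comm w (scalarMatrix ℝ λ₁ i)) (scalarMatrix-*ᵥ λ₁ w i)) (-‿cong (∙-comm w (A i)))))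
             (trans (∙-∑ʳ w (λ l j → shift l * v l i * v l j)) (sum-cong-≋ λ l →
               trans (∙-scaleʳ (shift l * v l i) w (v l)) (trans (*-congˡ (∙-comm w (v l)))
                 (solve 3 (λ a b d → a :* b :* d := a :* d :* b) refl (shift l) (v l i) (v l ∙ w))))) ⟩
      B w i + sum (λ l → shift l * (v l ∙ w) * v l i) ∎

    B′≈B : ∀ {w} → Complement w → ∀ i → (B′ *ᵥ w) i ≈ B w i
    B′≈B {w} w⊥v i = trans (B′-*ᵥ w i) (trans
      (+-congˡ (∑-zero λ l → trans (*-congʳ (trans (*-congˡ (w⊥v l)) (zeroʳ _))) (zeroˡ _)))
      (+-identityʳ _))

    -- The point of the shifts: a vector killed by `B′` is orthogonal to every `v i`, hence lies in
    -- the complement, where `B′` agrees with `B`.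
    v∙B′w : ∀ i w → v i ∙ (B′ *ᵥ w) ≈ v i ∙ w
    v∙B′w i w = begin-equality
      v i ∙ (B′ *ᵥ w)
        ≈⟨ ∙-cong {u = v i} (λ _ → refl) (B′-*ᵥ w) ⟩
      v i ∙ (λ j → B w j + sum λ l → shift l * (v l ∙ w) * v l j)
        ≈⟨ ∙-distribˡ-+ (v i) (B w) (λ j → sum λ l → shift l * (v l ∙ w) * v l j) ⟩
      v i ∙ B w + v i ∙ (λ j → sum λ l → shift l * (v l ∙ w) * v l j)
        ≈⟨ +-cong (v∙Bw i w) (trans (∙-∑ʳ (v i) (λ l j → shift l * (v l ∙ w) * v l j))
             (trans (sum-cong-≋ λ l → ∙-scaleʳ (shift l * (v l ∙ w)) (v i) (v l))
               (∑-single i λ l i≢l → trans (*-congˡ (orthogonal i≢l)) (zeroʳ _)))) ⟩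
      (λ₁ - μ i) * (v i ∙ w) + shift i * (v i ∙ w) * (v i ∙ v i)
        ≈⟨ solve 5 (λ l m q g g⁻¹ → (l :- m) :* q :+ g⁻¹ :* (con (ℤ.+ 1) :- l :+ m) :* q :* g
             := (l :- m) :* q :+ g⁻¹ :* g :* ((con (ℤ.+ 1) :- l :+ m) :* q)) refl
             λ₁ (μ i) (v i ∙ w) (v i ∙ v i) ((v i ∙ v i) ⁻¹) ⟩
      (λ₁ - μ i) * (v i ∙ w) + (v i ∙ v i) ⁻¹ * (v i ∙ v i) * ((1# - λ₁ + μ i) * (v i ∙ w))
        ≈⟨ +-congˡ (*-congʳ (*-inverseˡ _ (0<⇒≉0 (nonZero i)))) ⟩
      (λ₁ - μ i) * (v i ∙ w) + 1# * ((1# - λ₁ + μ i) * (v i ∙ w))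
        ≈⟨ solve 3 (λ l m q → (l :- m) :* q :+ con (ℤ.+ 1) :* ((con (ℤ.+ 1) :- l :+ m) :* q) := q) refl
             λ₁ (μ i) (v i ∙ w) ⟩
      v i ∙ w ∎

    not-coercive : ∀ {C} → 0# < C → ¬ (∀ {w} → Complement w → w ∙ w ≤ C * (w ∙ B w))
    not-coercive {C} 0<C coercive = <⇒≱ (0<x⁻¹ 0<C) (0≤-x⇒x≤0 0≤-ε)
      where
      ε : Carrier
      ε = C ⁻¹
      smaller : UpperBound RayleighLowerBound (λ₁ - ε)
      smaller x (w , w⊥v , 0<w∙w , x≤) = *-cancelˡ-≤ 0<w∙w (begin
        (w ∙ w) * x                       ≈⟨ *-comm _ _ ⟩
        x * (w ∙ w)                       ≤⟨ x≤ ⟩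
        w ∙ (A *ᵥ w)                      ≈⟨ solve 2 (λ a b → b := a :- (a :- b)) refl (λ₁ * (w ∙ w)) _ ⟩
        λ₁ * (w ∙ w) - (λ₁ * (w ∙ w) - w ∙ (A *ᵥ w))
                                          ≈⟨ +-congˡ (-‿cong (∙-B w w)) ⟨
        λ₁ * (w ∙ w) - w ∙ B w            ≤⟨ 0≤y-x⇒x≤y (≤-respʳ rearranged
                                               (0≤x*y (inj₁ (0<x⁻¹ 0<C)) (x≤y⇒0≤y-x (coercive w⊥v)))) ⟩
        (w ∙ w) * (λ₁ - ε)                ∎)
        where
        rearranged : ε * (C * (w ∙ B w) - w ∙ w) ≈ (w ∙ w) * (λ₁ - ε) - (λ₁ * (w ∙ w) - w ∙ B w)
        rearranged = begin-equality
          ε * (C * (w ∙ B w) - w ∙ w)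
            ≈⟨ solve 4 (λ e d q n → e :* (d :* q :- n) := e :* d :* q :- e :* n) refl ε C (w ∙ B w) (w ∙ w) ⟩
          ε * C * (w ∙ B w) - ε * (w ∙ w)
            ≈⟨ +-congʳ (*-congʳ (*-inverseˡ _ (0<⇒≉0 0<C))) ⟩
          1# * (w ∙ B w) - ε * (w ∙ w)
            ≈⟨ solve 4 (λ e q n l → con (ℤ.+ 1) :* q :- e :* n := n :* (l :- e) :- (l :* n :- q)) refl
                 ε (w ∙ B w) (w ∙ w) λ₁ ⟩
          (w ∙ w) * (λ₁ - ε) - (λ₁ * (w ∙ w) - w ∙ B w) ∎
      0≤-ε : 0# ≤ - ε
      0≤-ε = ≤-respʳ (solve 2 (λ l e → l :- e :- l := :- e) refl λ₁ ε) (x≤y⇒0≤y-x (λ₁-least _ smaller))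

    -- Otherwise elimination would bound w ∙ w by C (B′ w ∙ B′ w). On the complement this is C (B w
    -- ∙ B w), which `B-norm` bounds by C K (w ∙ B w), and that is the coercivity already excluded.
    -- Since elimination decides between its alternatives, a kernel vector is left.
    B′-singular : Kernel B′
    B′-singular = [ (λ ker → ker) , (λ (_ , spans) → ⊥-elim (regular spans)) ]′ (eliminate B′)
      where
      regular : ¬ SpansCoordinates B′
      regular spans =
        let C , 0<C , inverseBound = spans-bound spans
            K , 0<K , norm         = B-norm
        in not-coercive (*-positive 0<C 0<K) λ {w} w⊥v → begin
          w ∙ w                        ≤⟨ inverseBound w ⟩
          C * ((B′ *ᵥ w) ∙ (B′ *ᵥ w))  ≈⟨ *-congˡ (∙-cong (B′≈B w⊥v) (B′≈B w⊥v)) ⟩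
          C * (B w ∙ B w)              ≤⟨ *-monoˡ-≤ (inj₁ 0<C) (norm w⊥v) ⟩
          C * (K * (w ∙ B w))          ≈⟨ *-assoc _ _ _ ⟨
          C * K * (w ∙ B w)            ∎

    extend : Kernel B′ → Eigenframe A (suc k)
    extend (u , u≉0 , B′u≈0) = record
      { vector     = u ◂ v
      ; value      = λ₁ ◂ μ
      ; orthogonal = orthogonal′
      ; nonZero    = λ where
          zero    → 0<v∙v u≉0
          (suc i) → nonZero i
      ; eigen      = λ where
          zero    j → trans (solve 2 (λ a b → b := a :- (a :- b)) refl (λ₁ * u j) _)
            (trans (+-congˡ (-‿cong (trans (sym (B′≈B u⊥v j)) (B′u≈0 j))))
              (trans (+-congˡ -0#≈0#) (+-identityʳ _)))
          (suc i) j → eigen i j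
      }
      where
      u⊥v : Complement u
      u⊥v i = trans (sym (v∙B′w i u)) (∙-zeroʳ (v i) B′u≈0)
      orthogonal′ : ∀ {i j} → ¬ (i ≡ j) → (u ◂ v) i ∙ (u ◂ v) j ≈ 0#
      orthogonal′ {zero}  {zero}  0≢0 = ⊥-elim (0≢0 ≡.refl)
      orthogonal′ {zero}  {suc j} _   = trans (∙-comm u (v j)) (u⊥v j)
      orthogonal′ {suc i} {zero}  _   = u⊥v i
      orthogonal′ {suc i} {suc j} i≢j = orthogonal (i≢j ∘ ≡.cong suc)

    extended : Eigenframe A (suc k)
    extended = extend B′-singular

  eigenframe : ∀ {n} {A : Matrix ℝ n} → Symmetric A → ∀ k → k ℕ.≤ n → Eigenframe A k
  eigenframe A-sym zero    _   = record
    { vector = λ () ; value = λ () ; orthogonal = λ {i} → ⊥-elim (Fin.¬Fin0 i) ; nonZero = λ () ; eigen = λ () }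
  eigenframe A-sym (suc k) k<n = NextEigenvector.extended A-sym (eigenframe A-sym k (ℕ.<⇒≤ k<n)) k<n

-- Determinants as alternating multilinear forms in the rows.

module Determinant {c ℓ₁ ℓ₂ : Level} (ℝ : Reals c ℓ₁ ℓ₂) where

  open RealArithmetic ℝ
  open RawSemiringDefs (Semiring.rawSemiring semiring) using (product; _^_)

  infix 4 _≋_
  _≋_ : ∀ {n} → Vector Carrier n → Vector Carrier n → Set ℓ₁
  u ≋ v = ∀ i → u i ≈ v i

  Rows : ℕ → ℕ → Set c
  Rows n m = Vec (Vector Carrier m) n

  sign : ∀ {n} → Fin n → Carrier
  sign j = (- 1#) ^ toℕ j

  dropColumn : ∀ {n} → Fin (suc n) → Vector Carrier (suc n) → Vector Carrier n
  dropColumn j r = r ∘ punchIn j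

  -- With the rows in a `Vec`, multilinearity and alternation can be defined by peeling off one row
  -- at a time, and column operations become `Vec.map`.
  detRows : ∀ {n} → Rows n n → Carrier
  detRows []      = 1#
  detRows (r ∷ R) = sum λ j → sign j * (r j * detRows (Vec.map (dropColumn j) R))

  det≈detRows : ∀ {n} (A : Matrix ℝ n) → det ℝ A ≈ detRows (tabulate A)
  det≈detRows {zero}  A = refl
  det≈detRows {suc n} A = sum-cong-≋ λ j → *-congˡ {sign j} (*-congˡ {A zero j} (trans
    (det≈detRows (λ i k → A (suc i) (punchIn j k)))
    (reflexive (≡.cong detRows (Vec.tabulate-∘ (dropColumn j) (A ∘ suc))))))

  det-cong : ∀ {n} {A B : Matrix ℝ n} → (∀ i → A i ≋ B i) → det ℝ A ≈ det ℝ B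
  det-cong {zero}  A≋B = refl
  det-cong {suc n} A≋B = sum-cong-≋ λ j → *-congˡ {sign j} (*-cong (A≋B zero j)
    (det-cong λ i k → A≋B (suc i) (punchIn j k)))

  record Linear {m} (f : Vector Carrier m → Carrier) : Set (c ⊔ ℓ₁) where
    field
      resp      : ∀ {u v} → u ≋ v → f u ≈ f v
      additive  : ∀ u v → f (λ i → u i + v i) ≈ f u + f v
      homogeneous : ∀ a u → f (λ i → a * u i) ≈ a * f u

    ∑-homo : ∀ {k} (u : Fin k → Vector Carrier m) → f (λ i → sum λ j → u j i) ≈ sum λ j → f (u j)
    ∑-homo {zero}  u = trans (resp (λ _ → sym (zeroˡ 0#)))
      (trans (homogeneous 0# (λ _ → 0#)) (zeroˡ _))
    ∑-homo {suc k} u = trans (additive (u zero) _) (+-congˡ (∑-homo (u ∘ suc)))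

  LinearMap : ∀ {m l} → (Vector Carrier m → Vector Carrier l) → Set (c ⊔ ℓ₁)
  LinearMap φ = ∀ i → Linear (λ r → φ r i)

  MultiLinear : ∀ {n m} → (Rows n m → Carrier) → Set (c ⊔ ℓ₁)
  MultiLinear {zero}  f = ⊤
  MultiLinear {suc n} f = (∀ R → Linear (λ r → f (r ∷ R))) × (∀ r → MultiLinear (λ R → f (r ∷ R)))

  -- Only neighbouring equal rows are mentioned, which is what the Laplace expansion yields
  -- directly. For multilinear forms, equal rows at a distance are treated in
  -- `alternating⇒vanishesAt`.
  Alternating : ∀ {n m} → (Rows n m → Carrier) → Set (c ⊔ ℓ₁)
  Alternating {zero}        f = ⊤
  Alternating {suc zero}    f = ⊤
  Alternating {suc (suc n)} f = (∀ r R → f (r ∷ r ∷ R) ≈ 0#) × (∀ r → Alternating (λ R → f (r ∷ R)))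

  linear-∑ : ∀ {k m} {f : Fin k → Vector Carrier m → Carrier} →
             (∀ j → Linear (f j)) → Linear (λ r → sum λ j → f j r)
  linear-∑ {f = f} L = record
    { resp        = λ u≋v → sum-cong-≋ λ j → resp (L j) u≋v
    ; additive    = λ u v → trans (sum-cong-≋ λ j → additive (L j) u v) (∑-distrib-+ (λ j → f j u) (λ j → f j v))
    ; homogeneous = λ a u → trans (sum-cong-≋ λ j → homogeneous (L j) a u) (sym (*-distribˡ-sum a (λ j → f j u)))
    }
    where open Linear

  linear-scale : ∀ {m} {f : Vector Carrier m → Carrier} s → Linear f → Linear (λ r → s * f r)
  linear-scale {f = f} s L = record
    { resp        = λ u≋v → *-congˡ (resp u≋v)
    ; additive    = λ u v → trans (*-congˡ (additive u v)) (distribˡ s (f u) (f v))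
    ; homogeneous = λ a u → trans (*-congˡ (homogeneous a u))
        (solve 3 (λ s a x → s :* (a :* x) := a :* (s :* x)) refl s a (f u))
    }
    where open Linear L

  linear-coordinate : ∀ {m} a (j : Fin m) → Linear (λ r → r j * a)
  linear-coordinate a j = record
    { resp        = λ u≋v → *-congʳ (u≋v j)
    ; additive    = λ u v → distribʳ a (u j) (v j)
    ; homogeneous = λ b u → *-assoc b (u j) a
    }

  linear-∘ : ∀ {m l} {f : Vector Carrier l → Carrier} {φ : Vector Carrier m → Vector Carrier l} →
             Linear f → LinearMap φ → Linear (f ∘ φ)
  linear-∘ L Φ = record
    { resp        = λ u≋v → resp L (λ i → resp (Φ i) u≋v)
    ; additive    = λ u v → trans (resp L (λ i → additive (Φ i) u v)) (additive L _ _)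
    ; homogeneous = λ a u → trans (resp L (λ i → homogeneous (Φ i) a u)) (homogeneous L a _)
    }
    where open Linear

  multiLinear-∑ : ∀ {k n m} {f : Fin k → Rows n m → Carrier} →
                  (∀ j → MultiLinear (f j)) → MultiLinear (λ R → sum λ j → f j R)
  multiLinear-∑ {n = zero}  M = tt
  multiLinear-∑ {n = suc n} M = (λ R → linear-∑ λ j → proj₁ (M j) R) , (λ r → multiLinear-∑ λ j → proj₂ (M j) r)

  multiLinear-scale : ∀ {n m} {f : Rows n m → Carrier} s → MultiLinear f → MultiLinear (λ R → s * f R)
  multiLinear-scale {zero}  s M = tt
  multiLinear-scale {suc n} s M = (λ R → linear-scale s (proj₁ M R)) , (λ r → multiLinear-scale s (proj₂ M r))

  multiLinear-map : ∀ {n m l} {f : Rows n l → Carrier} {φ : Vector Carrier m → Vector Carrier l} →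
                    LinearMap φ → MultiLinear f → MultiLinear (λ R → f (Vec.map φ R))
  multiLinear-map {zero}          Φ M = tt
  multiLinear-map {suc n} {φ = φ} Φ M =
    (λ R → linear-∘ (proj₁ M (Vec.map φ R)) Φ) , (λ r → multiLinear-map Φ (proj₂ M (φ r)))

  multiLinear-resp-map : ∀ {n m l} {f : Rows n l → Carrier} {φ ψ : Vector Carrier m → Vector Carrier l} →
                         MultiLinear f → (∀ r → φ r ≋ ψ r) → ∀ R → f (Vec.map φ R) ≈ f (Vec.map ψ R)
  multiLinear-resp-map         M φ≋ψ []      = refl
  multiLinear-resp-map {φ = φ} M φ≋ψ (r ∷ R) = trans
    (multiLinear-resp-map (proj₂ M (φ r)) φ≋ψ R) (Linear.resp (proj₁ M _) (φ≋ψ r))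

  alternating-∑ : ∀ {k n m} {f : Fin k → Rows n m → Carrier} →
                  (∀ j → Alternating (f j)) → Alternating (λ R → sum λ j → f j R)
  alternating-∑ {n = zero}        M = tt
  alternating-∑ {n = suc zero}    M = tt
  alternating-∑ {n = suc (suc n)} M =
    (λ r R → ∑-zero λ j → proj₁ (M j) r R) , (λ r → alternating-∑ λ j → proj₂ (M j) r)

  alternating-scale : ∀ {n m} {f : Rows n m → Carrier} s → Alternating f → Alternating (λ R → s * f R)
  alternating-scale {zero}        s M = tt
  alternating-scale {suc zero}    s M = tt
  alternating-scale {suc (suc n)} s M =
    (λ r R → trans (*-congˡ (proj₁ M r R)) (zeroʳ s)) , (λ r → alternating-scale s (proj₂ M r))

  alternating-map : ∀ {n m l} {f : Rows n l → Carrier} (φ : Vector Carrier m → Vector Carrier l) →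
                    Alternating f → Alternating (λ R → f (Vec.map φ R))
  alternating-map {zero}        φ M = tt
  alternating-map {suc zero}    φ M = tt
  alternating-map {suc (suc n)} φ M =
    (λ r R → proj₁ M (φ r) (Vec.map φ R)) , (λ r → alternating-map φ (proj₂ M (φ r)))

  alternating-tail : ∀ {n m} {f : Rows (suc n) m → Carrier} → Alternating f → ∀ r → Alternating (λ R → f (r ∷ R))
  alternating-tail {zero}  _   r = tt
  alternating-tail {suc n} Alt r = proj₂ Alt r

  dropColumn-linear : ∀ {n} (j : Fin (suc n)) → LinearMap (dropColumn j)
  dropColumn-linear j i = record
    { resp = λ u≋v → u≋v (punchIn j i) ; additive = λ _ _ → refl ; homogeneous = λ _ _ → refl }

  detRows-multiLinear : ∀ {n} → MultiLinear (detRows {n})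
  detRows-multiLinear {zero}  = tt
  detRows-multiLinear {suc n} =
      (λ R → linear-∑ λ j → linear-scale (sign j) (linear-coordinate (detRows (Vec.map (dropColumn j) R)) j))
    , (λ r → multiLinear-∑ λ j → multiLinear-scale (sign j) (multiLinear-scale (r j)
        (multiLinear-map (dropColumn-linear j) detRows-multiLinear)))

  -- The pair (punchIn j k , j) consists of the same two indices as (j , punchIn j k),
  -- and pinch j k is j seen from within the complement of punchIn j k.
  pinch : ∀ {n} → Fin (suc n) → Fin n → Fin n
  pinch {suc n} zero    k       = zero
  pinch {suc n} (suc j) zero    = j
  pinch {suc n} (suc j) (suc k) = suc (pinch j k)

  punchIn-pinch : ∀ {n} (j : Fin (suc n)) k → punchIn (punchIn j k) (pinch j k) ≡ j
  punchIn-pinch {suc n} zero    k       = ≡.refl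
  punchIn-pinch {suc n} (suc j) zero    = ≡.refl
  punchIn-pinch {suc n} (suc j) (suc k) = ≡.cong suc (punchIn-pinch j k)

  punchIn-comm : ∀ {n} (j : Fin (suc (suc n))) k l →
                 punchIn (punchIn j k) (punchIn (pinch j k) l) ≡ punchIn j (punchIn k l)
  punchIn-comm         zero    k       l       = ≡.refl
  punchIn-comm         (suc j) zero    l       = ≡.refl
  punchIn-comm {suc n} (suc j) (suc k) zero    = ≡.refl
  punchIn-comm {suc n} (suc j) (suc k) (suc l) = ≡.cong suc (punchIn-comm j k l)

  -- Each unordered pair of columns is met twice, with opposite signs. In the induction, the pairs
  -- (0 , k) cancel against (k + 1 , 0), and the remaining pairs form the same sum one size smaller,
  -- the two extra signs multiplying to 1.
  signedPairs-cancel : ∀ {n} (F : Fin (suc n) → Fin n → Carrier) →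
                       (∀ j k → F j k ≈ F (punchIn j k) (pinch j k)) →
                       sum (λ j → sign j * sum λ k → sign k * F j k) ≈ 0#
  signedPairs-cancel {zero}  F F-sym = ∑-zero {1} {λ j → sign j * 0#} λ j → zeroʳ (sign j)
  signedPairs-cancel {suc n} F F-sym = begin-equality
    1# * S₀ + sum (λ j → - 1# * sign j * (1# * F (suc j) zero + sum λ k → - 1# * sign k * F (suc j) (suc k)))
      ≈⟨ +-cong (*-identityˡ S₀) (sum-cong-≋ λ j → trans
           (*-congˡ {x = - 1# * sign j} (+-congˡ {x = 1# * F (suc j) zero} (trans
             (sum-cong-≋ λ k → *-assoc (- 1#) (sign k) (F (suc j) (suc k)))
             (sym (*-distribˡ-sum (- 1#) (λ k → sign k * F (suc j) (suc k)))))))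
           (solve 3 (λ s x t → (:- con (ℤ.+ 1)) :* s :* (con (ℤ.+ 1) :* x :+ (:- con (ℤ.+ 1)) :* t)
             := s :* t :- s :* x) refl (sign j) (F (suc j) zero) (sum λ k → sign k * F (suc j) (suc k)))) ⟩
    S₀ + sum (λ j → sign j * sum (λ k → sign k * F (suc j) (suc k)) - sign j * F (suc j) zero)
      ≈⟨ +-congˡ (∑-distrib-- (λ j → sign j * sum λ k → sign k * F (suc j) (suc k)) (λ j → sign j * F (suc j) zero)) ⟩
    S₀ + (sum (λ j → sign j * sum λ k → sign k * F (suc j) (suc k)) - sum (λ j → sign j * F (suc j) zero))
      ≈⟨ +-congˡ (+-cong (signedPairs-cancel (λ j k → F (suc j) (suc k)) (λ j k → F-sym (suc j) (suc k)))
           (-‿cong (sum-cong-≋ λ j → *-congˡ {sign j} (sym (F-sym zero j))))) ⟩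
    S₀ + (0# - S₀)
      ≈⟨ solve 1 (λ s → s :+ (con (ℤ.+ 0) :- s) := con (ℤ.+ 0)) refl S₀ ⟩
    0# ∎
    where
    S₀ = sum λ k → sign k * F zero k

  -- Expanding along both of two equal leading rows gives a signed sum over ordered pairs of
  -- distinct columns whose terms `F`, two entries times a double minor, depend only on the
  -- unordered pair.
  detRows-alternating : ∀ {n} → Alternating (detRows {n})
  detRows-alternating {zero}        = tt
  detRows-alternating {suc zero}    = tt
  detRows-alternating {suc (suc n)} =
      (λ r R → trans (sum-cong-≋ λ j → *-congˡ {sign j} (expand r R j)) (signedPairs-cancel (F r R) (F-sym r R)))
    , (λ r → alternating-∑ λ j → alternating-scale (sign j) (alternating-scale (r j)
        (alternating-map (dropColumn j) detRows-alternating)))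
    where
    D : Rows n (suc (suc n)) → Fin (suc (suc n)) → Fin (suc n) → Carrier
    D R j k = detRows (Vec.map (dropColumn k ∘ dropColumn j) R)
    F : Vector Carrier (suc (suc n)) → Rows n (suc (suc n)) → Fin (suc (suc n)) → Fin (suc n) → Carrier
    F r R j k = r j * (r (punchIn j k) * D R j k)
    expand : ∀ r R j → r j * detRows (Vec.map (dropColumn j) (r ∷ R)) ≈ sum (λ k → sign k * F r R j k)
    expand r R j = trans
      (*-distribˡ-sum (r j) (λ k → sign k * (r (punchIn j k) * detRows (Vec.map (dropColumn k) (Vec.map (dropColumn j) R)))))
      (sum-cong-≋ λ k → trans
        (solve 4 (λ a s b d → a :* (s :* (b :* d)) := s :* (a :* (b :* d))) refl (r j) (sign k) (r (punchIn j k)) _)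
        (*-congˡ {sign k} (*-congˡ (*-congˡ
          (reflexive (≡.cong detRows (≡.sym (Vec.map-∘ (dropColumn k) (dropColumn j) R))))))))
    F-sym : ∀ r R j k → F r R j k ≈ F r R (punchIn j k) (pinch j k)
    F-sym r R j k = begin-equality
      r j * (r p * D R j k)
        ≈⟨ solve 3 (λ a b d → a :* (b :* d) := b :* (a :* d)) refl (r j) (r p) (D R j k) ⟩
      r p * (r j * D R j k)
        ≈⟨ *-congˡ (*-cong (reflexive (≡.cong r (≡.sym (punchIn-pinch j k))))
             (multiLinear-resp-map detRows-multiLinear
               (λ row l → reflexive (≡.cong row (≡.sym (punchIn-comm j k l)))) R)) ⟩
      F r R p (pinch j k) ∎
      where p = punchIn j k

  -- Uniqueness of the determinant and its multiplicativity.

  -- Polarisation: expand the vanishing value at u + v in both of the first two rows.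
  alternating-swap : ∀ {n m} {f : Rows (suc (suc n)) m → Carrier} → MultiLinear f → Alternating f →
                     ∀ u v R → f (u ∷ v ∷ R) ≈ - f (v ∷ u ∷ R)
  alternating-swap {f = f} M Alt u v R = begin-equality
    f (u ∷ v ∷ R)
      ≈⟨ solve 2 (λ x y → x := (con (ℤ.+ 0) :+ x :+ (y :+ con (ℤ.+ 0))) :- y) refl (f (u ∷ v ∷ R)) (f (v ∷ u ∷ R)) ⟩
    (0# + f (u ∷ v ∷ R) + (f (v ∷ u ∷ R) + 0#)) - f (v ∷ u ∷ R)
      ≈⟨ +-congʳ (+-cong (+-congʳ (proj₁ Alt u R)) (+-congˡ (proj₁ Alt v R))) ⟨
    (f (u ∷ u ∷ R) + f (u ∷ v ∷ R) + (f (v ∷ u ∷ R) + f (v ∷ v ∷ R))) - f (v ∷ u ∷ R)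
      ≈⟨ +-congʳ (+-cong (Linear.additive (proj₁ (proj₂ M u) R) u v) (Linear.additive (proj₁ (proj₂ M v) R) u v)) ⟨
    (f (u ∷ u+v ∷ R) + f (v ∷ u+v ∷ R)) - f (v ∷ u ∷ R)
      ≈⟨ +-congʳ (Linear.additive (proj₁ M (u+v ∷ R)) u v) ⟨
    f (u+v ∷ u+v ∷ R) - f (v ∷ u ∷ R)
      ≈⟨ +-congʳ (proj₁ Alt u+v R) ⟩
    0# - f (v ∷ u ∷ R)
      ≈⟨ +-identityˡ _ ⟩
    - f (v ∷ u ∷ R) ∎
    where
    u+v = λ i → u i + v i

  VanishesAt : ∀ {n m} → Vector Carrier m → (Rows n m → Carrier) → Set (c ⊔ ℓ₁)
  VanishesAt {zero}  e g = ⊤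
  VanishesAt {suc n} e g = (∀ R → g (e ∷ R) ≈ 0#) × (∀ r → VanishesAt e (λ R → g (r ∷ R)))

  vanishesAt-neg : ∀ {n m} {e : Vector Carrier m} {g h : Rows n m → Carrier} →
                   (∀ R → g R ≈ - h R) → VanishesAt e h → VanishesAt e g
  vanishesAt-neg {zero}  g≈-h V = tt
  vanishesAt-neg {suc n} g≈-h V =
      (λ R → trans (g≈-h _) (trans (-‿cong (proj₁ V R)) -0#≈0#))
    , (λ r → vanishesAt-neg (λ R → g≈-h (r ∷ R)) (proj₂ V r))

  -- The leading e is swapped past one row after another, at the cost of a sign each, until it meets
  -- its copy.
  alternating⇒vanishesAt : ∀ {n m} {f : Rows (suc n) m → Carrier} → MultiLinear f → Alternating f →
                           ∀ e → VanishesAt e (λ R → f (e ∷ R))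
  alternating⇒vanishesAt {zero}  M Alt e = tt
  alternating⇒vanishesAt {suc n} {f = f} M Alt e = proj₁ Alt e , λ r →
    vanishesAt-neg (alternating-swap {f = f} M Alt e r)
      (alternating⇒vanishesAt {f = λ R → f (r ∷ R)} (proj₂ M r) (proj₂ Alt r) e)

  -- Multiples of e may be subtracted from all rows simultaneously. With e the j-th basis vector,
  -- this clears column j below a first row `basis j`.
  shear-invariant : ∀ {n m} {e : Vector Carrier m} {g : Rows n m → Carrier} → MultiLinear g → VanishesAt e g →
                    ∀ {φ : Vector Carrier m → Vector Carrier m} {a : Vector Carrier m → Carrier} →
                    (∀ r → r ≋ λ i → φ r i + a r * e i) → ∀ R → g R ≈ g (Vec.map φ R)
  shear-invariant M V r≋ [] = refl
  shear-invariant {e = e} {g} M V {φ} {a} r≋ (r ∷ R) = begin-equality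
    g (r ∷ R)                                     ≈⟨ resp (r≋ r) ⟩
    g ((λ i → φ r i + a r * e i) ∷ R)             ≈⟨ additive (φ r) (λ i → a r * e i) ⟩
    g (φ r ∷ R) + g ((λ i → a r * e i) ∷ R)       ≈⟨ +-congˡ (trans (homogeneous (a r) e)
                                                       (trans (*-congˡ (proj₁ V R)) (zeroʳ (a r)))) ⟩
    g (φ r ∷ R) + 0#                              ≈⟨ +-identityʳ _ ⟩
    g (φ r ∷ R)                                   ≈⟨ shear-invariant (proj₂ M (φ r)) (proj₂ V (φ r)) r≋ R ⟩
    g (φ r ∷ Vec.map φ R)                         ∎
    where open Linear (proj₁ M R)

  insertZero : ∀ {n} → Fin (suc n) → Vector Carrier n → Vector Carrier (suc n)
  insertZero j u = insertAt u j 0#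

  basis : ∀ {n} → Fin n → Vector Carrier n
  basis zero    = 1# ◂ λ _ → 0#
  basis (suc j) = insertZero zero (basis j)

  -- Built recursively so that `expandAt f zero identity` is `f identity` by computation.
  identity : ∀ {n} → Rows n n
  identity {zero}  = []
  identity {suc n} = basis zero ∷ Vec.map (insertZero zero) identity

  identity≡tabulate-basis : ∀ {n} → identity {n} ≡ tabulate basis
  identity≡tabulate-basis {zero}  = ≡.refl
  identity≡tabulate-basis {suc n} = ≡.cong (basis zero ∷_)
    (≡.trans (≡.cong (Vec.map (insertZero zero)) identity≡tabulate-basis) (≡.sym (Vec.tabulate-∘ (insertZero zero) basis)))

  basis-expansion : ∀ {n} (r : Vector Carrier n) → r ≋ λ k → sum λ j → r j * basis j k
  basis-expansion r zero    = sym (trans (+-cong (*-identityʳ _) (∑-zero λ j → zeroʳ (r (suc j)))) (+-identityʳ _))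
  basis-expansion r (suc k) = sym (trans (+-cong (zeroʳ _) (sym (basis-expansion (r ∘ suc) k))) (+-identityˡ _))

  insertZero-linear : ∀ {n} (j : Fin (suc n)) → LinearMap (insertZero j)
  insertZero-linear j i = record
    { resp        = λ u≋v → insert-resp j u≋v i
    ; additive    = λ u v → insert-+ j u v i
    ; homogeneous = λ a u → insert-* j a u i
    }
    where
    insert-resp : ∀ {n} (j : Fin (suc n)) {u v : Vector Carrier n} → u ≋ v → insertZero j u ≋ insertZero j v
    insert-resp         zero    u≋v zero    = refl
    insert-resp         zero    u≋v (suc i) = u≋v i
    insert-resp {suc n} (suc j) u≋v zero    = u≋v zero
    insert-resp {suc n} (suc j) u≋v (suc i) = insert-resp j (u≋v ∘ suc) i
    insert-+ : ∀ {n} (j : Fin (suc n)) (u v : Vector Carrier n) →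
               insertZero j (λ i → u i + v i) ≋ λ i → insertZero j u i + insertZero j v i
    insert-+         zero    u v zero    = sym (+-identityˡ 0#)
    insert-+         zero    u v (suc i) = refl
    insert-+ {suc n} (suc j) u v zero    = refl
    insert-+ {suc n} (suc j) u v (suc i) = insert-+ j (u ∘ suc) (v ∘ suc) i
    insert-* : ∀ {n} (j : Fin (suc n)) a (u : Vector Carrier n) →
               insertZero j (λ i → a * u i) ≋ λ i → a * insertZero j u i
    insert-*         zero    a u zero    = sym (zeroʳ a)
    insert-*         zero    a u (suc i) = refl
    insert-* {suc n} (suc j) a u zero    = refl
    insert-* {suc n} (suc j) a u (suc i) = insert-* j a (u ∘ suc) i

  splitColumn : ∀ {n} (j : Fin (suc n)) r → r ≋ λ k → insertZero j (dropColumn j r) k + r j * basis j k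
  splitColumn         zero    r zero    = sym (trans (+-identityˡ _) (*-identityʳ _))
  splitColumn         zero    r (suc k) = sym (trans (+-congˡ (zeroʳ _)) (+-identityʳ _))
  splitColumn {suc n} (suc j) r zero    = sym (trans (+-congˡ (zeroʳ _)) (+-identityʳ _))
  splitColumn {suc n} (suc j) r (suc k) = splitColumn j (r ∘ suc) k

  -- The inductive step for forms: the result is again multilinear and alternating, in one row and
  -- one column fewer, and captures f once its first row is `basis j` and column j is cleared.
  expandAt : ∀ {n} → (Rows (suc n) (suc n) → Carrier) → Fin (suc n) → Rows n n → Carrier
  expandAt f j M = f (basis j ∷ Vec.map (insertZero j) M)

  expandAt-multiLinear : ∀ {n} {f : Rows (suc n) (suc n) → Carrier} → MultiLinear f →
                         ∀ j → MultiLinear (expandAt f j)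
  expandAt-multiLinear M j = multiLinear-map (insertZero-linear j) (proj₂ M (basis j))

  expandAt-alternating : ∀ {n} {f : Rows (suc n) (suc n) → Carrier} → Alternating f →
                         ∀ j → Alternating (expandAt f j)
  expandAt-alternating {f = f} Alt j = alternating-map (insertZero j) (alternating-tail {f = f} Alt (basis j))

  -- `basis j` has to travel from the first row to its own place. One swap brings `basis (suc j)`
  -- into the second row; the rest of the way is the claim for `expandAt f zero` and j.
  expandAt-identity : ∀ {n} {f : Rows (suc n) (suc n) → Carrier} → MultiLinear f → Alternating f →
                      ∀ j → expandAt f j identity ≈ sign j * f identity
  expandAt-identity                 M Alt zero    = sym (*-identityˡ _)
  expandAt-identity {suc n} {f = f} M Alt (suc j) = begin-equality
    f (basis (suc j) ∷ insertZero (suc j) (basis zero) ∷ Vec.map (insertZero (suc j)) (Vec.map (insertZero zero) identity))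
      ≈⟨ alternating-swap {f = f} M Alt (basis (suc j)) (insertZero (suc j) (basis zero)) _ ⟩
    - f (insertZero (suc j) (basis zero) ∷ basis (suc j) ∷ Vec.map (insertZero (suc j)) (Vec.map (insertZero zero) identity))
      ≈⟨ -‿cong (Linear.resp (proj₁ M _) insert-basis) ⟩
    - f (basis zero ∷ basis (suc j) ∷ Vec.map (insertZero (suc j)) (Vec.map (insertZero zero) identity))
      ≈⟨ -‿cong (trans (reflexive (≡.cong tailValue (≡.sym (Vec.map-∘ (insertZero (suc j)) (insertZero zero) identity))))
           (trans (multiLinear-resp-map (proj₂ (proj₂ M (basis zero)) (basis (suc j))) insert-comm identity)
             (reflexive (≡.cong tailValue (Vec.map-∘ (insertZero zero) (insertZero j) identity))))) ⟩
    - expandAt (expandAt f zero) j identity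
      ≈⟨ -‿cong (expandAt-identity {f = expandAt f zero}
           (expandAt-multiLinear {f = f} M zero) (expandAt-alternating {f = f} Alt zero) j) ⟩
    - (sign j * f identity)
      ≈⟨ solve 2 (λ s x → :- (s :* x) := (:- con (ℤ.+ 1)) :* s :* x) refl (sign j) (f identity) ⟩
    sign (suc j) * f identity ∎
    where
    tailValue : Rows n (suc (suc n)) → Carrier
    tailValue R = f (basis zero ∷ basis (suc j) ∷ R)
    insert-zeros : ∀ {n} (j : Fin (suc n)) → insertZero j (λ _ → 0#) ≋ λ _ → 0#
    insert-zeros         zero    zero    = refl
    insert-zeros         zero    (suc i) = refl
    insert-zeros {suc n} (suc j) zero    = refl
    insert-zeros {suc n} (suc j) (suc i) = insert-zeros j i
    insert-basis : insertZero (suc j) (basis zero) ≋ basis zero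
    insert-basis zero    = refl
    insert-basis (suc i) = insert-zeros j i
    insert-comm : ∀ r → insertZero (suc j) (insertZero zero r) ≋ insertZero zero (insertZero j r)
    insert-comm r zero    = refl
    insert-comm r (suc i) = refl

  -- Write the first row in the standard basis; for each basis vector clear its column from the
  -- other rows and apply the induction hypothesis to `expandAt f j`. What results is the Laplace
  -- expansion.
  detRows-unique : ∀ {n} {f : Rows n n → Carrier} → MultiLinear f → Alternating f →
                   ∀ R → f R ≈ detRows R * f identity
  detRows-unique                 M Alt []      = sym (*-identityˡ _)
  detRows-unique {suc n} {f = f} M Alt (r ∷ R) = begin-equality
    f (r ∷ R)
      ≈⟨ resp (basis-expansion r) ⟩
    f ((λ k → sum λ j → r j * basis j k) ∷ R)
      ≈⟨ ∑-homo (λ j k → r j * basis j k) ⟩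
    sum (λ j → f ((λ k → r j * basis j k) ∷ R))
      ≈⟨ sum-cong-≋ (λ j → trans (homogeneous (r j) (basis j)) (trans (*-congˡ {r j} (cofactor j))
           (solve 4 (λ a d s x → a :* (d :* (s :* x)) := s :* (a :* d) :* x) refl
             (r j) (detRows (Vec.map (dropColumn j) R)) (sign j) (f identity)))) ⟩
    sum (λ j → sign j * (r j * detRows (Vec.map (dropColumn j) R)) * f identity)
      ≈⟨ *-distribʳ-sum (f identity) (λ j → sign j * (r j * detRows (Vec.map (dropColumn j) R))) ⟨
    detRows (r ∷ R) * f identity ∎
    where
    open Linear (proj₁ M R)
    cofactor : ∀ j → f (basis j ∷ R) ≈ detRows (Vec.map (dropColumn j) R) * (sign j * f identity)
    cofactor j = begin-equality
      f (basis j ∷ R)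
        ≈⟨ shear-invariant (proj₂ M (basis j)) (alternating⇒vanishesAt {f = f} M Alt (basis j)) (splitColumn j) R ⟩
      f (basis j ∷ Vec.map (insertZero j ∘ dropColumn j) R)
        ≡⟨ ≡.cong (λ R → f (basis j ∷ R)) (Vec.map-∘ (insertZero j) (dropColumn j) R) ⟩
      expandAt f j (Vec.map (dropColumn j) R)
        ≈⟨ detRows-unique {f = expandAt f j} (expandAt-multiLinear {f = f} M j) (expandAt-alternating {f = f} Alt j) (Vec.map (dropColumn j) R) ⟩
      detRows (Vec.map (dropColumn j) R) * expandAt f j identity
        ≈⟨ *-congˡ {detRows (Vec.map (dropColumn j) R)} (expandAt-identity {f = f} M Alt j) ⟩
      detRows (Vec.map (dropColumn j) R) * (sign j * f identity) ∎

  -- For fixed B, the determinant of the product is multilinear and alternating in the rows of A,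
  -- and its value at the identity is that of B.
  det-* : ∀ {n} (A B : Matrix ℝ n) → det ℝ (λ i k → sum λ j → A i j * B j k) ≈ det ℝ A * det ℝ B
  det-* {n} A B = begin-equality
    det ℝ (λ i → A i ·B)
      ≈⟨ det≈detRows (λ i → A i ·B) ⟩
    detRows (tabulate (λ i → A i ·B))
      ≡⟨ ≡.cong detRows (Vec.tabulate-∘ _·B A) ⟩
    detRows (Vec.map _·B (tabulate A))
      ≈⟨ detRows-unique (multiLinear-map ·B-linear detRows-multiLinear)
           (alternating-map _·B detRows-alternating) (tabulate A) ⟩
    detRows (tabulate A) * detRows (Vec.map _·B identity)
      ≡⟨ ≡.cong (λ I → detRows (tabulate A) * detRows I)
           (≡.trans (≡.cong (Vec.map _·B) identity≡tabulate-basis) (≡.sym (Vec.tabulate-∘ _·B basis))) ⟩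
    detRows (tabulate A) * detRows (tabulate (λ j → basis j ·B))
      ≈⟨ *-cong (sym (det≈detRows A)) (trans (sym (det≈detRows (λ j → basis j ·B))) (det-cong basis·B)) ⟩
    det ℝ A * det ℝ B ∎
    where
    infix 8 _·B
    _·B : Vector Carrier n → Vector Carrier n
    (r ·B) k = sum λ j → r j * B j k
    ·B-linear : LinearMap _·B
    ·B-linear k = linear-∑ λ j → linear-coordinate (B j k) j
    basis· : ∀ {n} (u : Vector Carrier n) j → sum (λ i → basis j i * u i) ≈ u j
    basis· u zero    = trans (+-cong (*-identityˡ _) (∑-zero λ i → zeroˡ (u (suc i)))) (+-identityʳ _)
    basis· u (suc j) = trans (+-cong (zeroˡ _) (basis· (u ∘ suc) j)) (+-identityˡ _)
    basis·B : ∀ j → basis j ·B ≋ B j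
    basis·B j k = basis· (λ i → B i k) j

  det-diagonal : ∀ {n} (A : Matrix ℝ n) → (∀ i j → ¬ (i ≡ j) → A i j ≈ 0#) → det ℝ A ≈ product (λ i → A i i)
  det-diagonal {zero}  A off = refl
  det-diagonal {suc n} A off = begin-equality
    det ℝ A
      ≈⟨ ∑-single zero (λ j 0≢j → trans (*-congˡ {sign j} (trans
           (*-congʳ {det ℝ (λ i k → A (suc i) (punchIn j k))} (off zero j 0≢j)) (zeroˡ _))) (zeroʳ (sign j))) ⟩
    1# * (A zero zero * det ℝ (λ i k → A (suc i) (suc k)))
      ≈⟨ *-identityˡ _ ⟩
    A zero zero * det ℝ (λ i k → A (suc i) (suc k))
      ≈⟨ *-congˡ (det-diagonal (λ i k → A (suc i) (suc k)) λ i k i≢k → off (suc i) (suc k) (i≢k ∘ Fin.suc-injective)) ⟩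
    product (λ i → A i i) ∎

-- Sylvester's law of inertia.

module Selection {a p} {A : Set a} {P : Pred A p} (P? : Decidable P) where

  -- Makes a count usable as a number of linear equations: one equation for each entry satisfying P.
  select : ∀ {n} (xs : Vec A n) → Fin (count P? xs) → Fin n
  select (x ∷ xs) j with P? x
  select (x ∷ xs) zero    | yes _ = zero
  select (x ∷ xs) (suc j) | yes _ = suc (select xs j)
  select (x ∷ xs) j       | no  _ = suc (select xs j)

  select-surjective : ∀ {n} (xs : Vec A n) i → P (lookup xs i) → ∃ λ j → select xs j ≡ i
  select-surjective (x ∷ xs) i p with P? x
  select-surjective (x ∷ xs) zero    p | yes _  = zero , ≡.refl
  select-surjective (x ∷ xs) zero    p | no  ¬p = ⊥-elim (¬p p)
  select-surjective (x ∷ xs) (suc i) p | yes _  =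
    let j , eq = select-surjective xs i p in suc j , ≡.cong suc eq
  select-surjective (x ∷ xs) (suc i) p | no  _  =
    let j , eq = select-surjective xs i p in j , ≡.cong suc eq

module Inertia {c ℓ₁ ℓ₂ : Level} (ℝ : Reals c ℓ₁ ℓ₂) where

  open RealArithmetic ℝ
  open LinearAlgebra ℝ
  open Spectral ℝ
  open Determinant ℝ
  open RawSemiringDefs (Semiring.rawSemiring semiring) using (product)
  open CommutativeMonoidSum *-commutativeMonoid using ()
    renaming (∑-distrib-+ to ∏-distrib-*; sum-cong-≋ to ∏-cong)

  -- The coefficients e and d of the forms are kept apart from the vectors whose entries are
  -- counted, so that the argument applies both to a form and to its negative, with counts of the
  -- original entries.
  module _ {n m p q} (μs : Vec Carrier n) (ds : Vec Carrier m)
           {P : Pred Carrier p} (P? : Decidable P) {Q : Pred Carrier q} (Q? : Decidable Q)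
           (e : Vector Carrier n) (d : Vector Carrier m) (L : Vector (Vector Carrier n) m) where

    -- Killing the terms with negative e and those with positive d leaves a form which is both
    -- nonnegative and nonpositive, so the equations imposed must have trivial kernel.
    dimension-bound : (∀ i → ¬ P (lookup μs i) → 0# ≤ e i) → (∀ l → ¬ Q (lookup ds l) → d l ≤ 0#) →
                      (∀ l → d l ≉ 0#) → (∀ x → (∀ l → L l ∙ x ≈ 0#) → ∀ i → x i ≈ 0#) →
                      (∀ x → sum (λ i → e i * (x i * x i)) ≈ sum (λ l → d l * ((L l ∙ x) * (L l ∙ x)))) →
                      n ℕ.≤ count P? μs ℕ.+ count Q? ds
    dimension-bound e≥0 d≤0 d≉0 regular forms =
      [ (λ ker → ⊥-elim (trivial ker)) , proj₁ ]′ (eliminate equations)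
      where
      coordinateRows : Vector (Vector Carrier n) (count P? μs)
      coordinateRows = scalarMatrix ℝ 1# ∘ Selection.select P? μs
      functionalRows : Vector (Vector Carrier n) (count Q? ds)
      functionalRows = L ∘ Selection.select Q? ds
      equations : Vector (Vector Carrier n) (count P? μs ℕ.+ count Q? ds)
      equations = coordinateRows ++ functionalRows

      trivial : ¬ Kernel equations
      trivial (x , (i , xᵢ≉0) , solves) = xᵢ≉0 (regular x Lx≈0 i)
        where
        P⇒x≈0 : ∀ i → P (lookup μs i) → x i ≈ 0#
        P⇒x≈0 i p with Selection.select-surjective P? μs i p
        ... | j , ≡.refl = trans (sym (trans (scalarMatrix-*ᵥ 1# x _) (*-identityˡ _)))
          (trans (reflexive (≡.cong (_∙ x) (≡.sym (lookup-++ˡ coordinateRows functionalRows j)))) (solves (j ↑ˡ _)))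

        Q⇒Lx≈0 : ∀ l → Q (lookup ds l) → L l ∙ x ≈ 0#
        Q⇒Lx≈0 l q with Selection.select-surjective Q? ds l q
        ... | j , ≡.refl = trans
          (reflexive (≡.cong (_∙ x) (≡.sym (lookup-++ʳ coordinateRows functionalRows j)))) (solves (_ ↑ʳ j))

        nonneg : ∀ i → 0# ≤ e i * (x i * x i)
        nonneg i with P? (lookup μs i)
        ... | no ¬p = 0≤x*y (e≥0 i ¬p) (0≤x*x (x i))
        ... | yes p = inj₂ (sym (trans (*-congˡ (trans (*-congˡ (P⇒x≈0 i p)) (zeroʳ _))) (zeroʳ _)))

        nonpos : ∀ l → 0# ≤ - (d l * ((L l ∙ x) * (L l ∙ x)))
        nonpos l with Q? (lookup ds l)
        ... | no ¬q = ≤-respʳ (solve 2 (λ d y → (:- d) :* y := :- (d :* y)) refl (d l) ((L l ∙ x) * (L l ∙ x)))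
                        (0≤x*y (x≤0⇒0≤-x (d≤0 l ¬q)) (0≤x*x (L l ∙ x)))
        ... | yes q = inj₂ (sym (trans
                        (-‿cong (trans (*-congˡ (trans (*-congˡ (Q⇒Lx≈0 l q)) (zeroʳ _))) (zeroʳ _))) -0#≈0#))

        ∑≤0 : sum (λ l → - (d l * ((L l ∙ x) * (L l ∙ x)))) ≤ 0#
        ∑≤0 = ≤-trans (inj₂ (trans (∑-neg (λ l → d l * ((L l ∙ x) * (L l ∙ x)))) (-‿cong (sym (forms x)))))
          (0≤-x⇒x≤0 (≤-respʳ (solve 1 (λ s → s := :- (:- s)) refl (sum λ i → e i * (x i * x i))) (0≤∑ nonneg)))

        Lx≈0 : ∀ l → L l ∙ x ≈ 0#
        Lx≈0 l = x*x≈0⇒x≈0 (a*x≈0⇒x≈0 (d≉0 l) (trans (solve 1 (λ s → s := :- (:- s)) refl (d l * ((L l ∙ x) * (L l ∙ x))))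
          (trans (-‿cong (∑≤0⇒≈0 nonpos ∑≤0 l)) -0#≈0#)))

  count-trichotomy : ∀ {n} (xs : Vec Carrier n) →
                     count (0# <?_) xs ℕ.+ (count (_≟ 0#) xs ℕ.+ count (_<? 0#) xs) ≡ n
  count-trichotomy []       = ≡.refl
  count-trichotomy (x ∷ xs) with 0# <? x | x ≟ 0# | x <? 0#
  ... | yes 0<x | yes x≈0 | _       = ⊥-elim (0<⇒≉0 0<x x≈0)
  ... | yes 0<x | no  _   | yes x<0 = ⊥-elim (<⇒≱ 0<x (inj₁ x<0))
  ... | yes _   | no  _   | no  _   = ≡.cong suc (count-trichotomy xs)
  ... | no  _   | yes x≈0 | yes x<0 = ⊥-elim (<-irrefl x≈0 x<0)
  ... | no  _   | yes _   | no  _   = ≡.trans (ℕ.+-suc (count (0# <?_) xs) _) (≡.cong suc (count-trichotomy xs))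
  ... | no  _   | no  _   | yes _   = ≡.trans
    (≡.cong (count (0# <?_) xs ℕ.+_) (ℕ.+-suc (count (_≟ 0#) xs) (count (_<? 0#) xs)))
    (≡.trans (ℕ.+-suc (count (0# <?_) xs) _) (≡.cong suc (count-trichotomy xs)))
  ... | no  0≮x | no  x≉0 | no  x≮0 = ⊥-elim (x≉0 (≤-antisym (≮⇒≥ 0≮x) (≮⇒≥ x≮0)))

  count-zero : ∀ {n} (xs : Vec Carrier n) → (∀ i → lookup xs i ≉ 0#) → count (_≟ 0#) xs ≡ 0
  count-zero []       xs≉0 = ≡.refl
  count-zero (x ∷ xs) xs≉0 with x ≟ 0#
  ... | yes x≈0 = ⊥-elim (xs≉0 zero x≈0)
  ... | no  _   = count-zero xs (xs≉0 ∘ suc)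

  module _ {n} {A : Matrix ℝ n} (frame : Eigenframe A n) where
    open Eigenframe frame renaming (vector to v; value to μ)

    private
      g : Vector Carrier n
      g i = v i ∙ v i

    ∏g≉0 : product g ≉ 0#
    ∏g≉0 = positive⇒∏≉0 nonZero
      where
      positive⇒∏≉0 : ∀ {k} {h : Vector Carrier k} → (∀ i → 0# < h i) → product h ≉ 0#
      positive⇒∏≉0 {zero}  0<h = 0<⇒≉0 0<1
      positive⇒∏≉0 {suc k} 0<h = a*x≉0 (0<⇒≉0 (0<h zero)) (positive⇒∏≉0 (0<h ∘ suc))

    charPoly-eigenframe : ∀ x → charPoly ℝ A x ≈ product (λ i → x - μ i)
    charPoly-eigenframe x = *-cancelˡ ∏g≉0 (begin-equality
      product g * det ℝ M
        ≈⟨ *-congʳ (trans (sym (det-diagonal (λ i k → v i ∙ v k) (λ i k → orthogonal))) (det-* v vᵀ)) ⟩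
      det ℝ v * det ℝ vᵀ * det ℝ M
        ≈⟨ solve 3 (λ a b d → a :* b :* d := a :* (d :* b)) refl (det ℝ v) (det ℝ vᵀ) (det ℝ M) ⟩
      det ℝ v * (det ℝ M * det ℝ vᵀ)
        ≈⟨ *-congˡ (trans (sym (det-* M vᵀ)) (det-cong M·vᵀ)) ⟩
      det ℝ v * det ℝ (λ j k → (x - μ k) * v k j)
        ≈⟨ det-* v (λ j k → (x - μ k) * v k j) ⟨
      det ℝ (λ i k → v i ∙ (λ j → (x - μ k) * v k j))
        ≈⟨ det-cong (λ i k → ∙-scaleʳ (x - μ k) (v i) (v k)) ⟩
      det ℝ (λ i k → (x - μ k) * (v i ∙ v k))
        ≈⟨ det-diagonal (λ i k → (x - μ k) * (v i ∙ v k))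
             (λ i k i≢k → trans (*-congˡ (orthogonal i≢k)) (zeroʳ _)) ⟩
      product (λ i → (x - μ i) * g i)
        ≈⟨ ∏-distrib-* (λ i → x - μ i) g ⟩
      product (λ i → x - μ i) * product g
        ≈⟨ *-comm (product λ i → x - μ i) (product g) ⟩
      product g * product (λ i → x - μ i) ∎)
      where
      M vᵀ : Matrix ℝ n
      M i j = scalarMatrix ℝ x i j - A i j
      vᵀ j k = v k j
      M·vᵀ : ∀ i k → M i ∙ v k ≈ (x - μ k) * v k i
      M·vᵀ i k = begin-equality
        M i ∙ v k
          ≈⟨ ∙-comm (M i) (v k) ⟩
        v k ∙ M i
          ≈⟨ ∙-distribˡ-- (v k) (scalarMatrix ℝ x i) (A i) ⟩
        v k ∙ scalarMatrix ℝ x i - v k ∙ A i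
          ≈⟨ +-cong (trans (∙-comm (v k) (scalarMatrix ℝ x i)) (scalarMatrix-*ᵥ x (v k) i))
               (-‿cong (trans (∙-comm (v k) (A i)) (eigen k i))) ⟩
        x * v k i - μ k * v k i
          ≈⟨ solve 3 (λ x m y → x :* y :- m :* y := (x :- m) :* y) refl x (μ k) (v k i) ⟩
        (x - μ k) * v k i ∎

    combination : Vector Carrier n → Vector Carrier n
    combination x j = sum λ i → x i * v i j

    v∙combination : ∀ l x → v l ∙ combination x ≈ x l * g l
    v∙combination l x = trans (∙-∑ʳ (v l) (λ i j → x i * v i j))
      (trans (sum-cong-≋ λ i → ∙-scaleʳ (x i) (v l) (v i))
        (∑-single l λ i l≢i → trans (*-congˡ (orthogonal l≢i)) (zeroʳ _)))

    form-combination : ∀ x → combination x ∙ (A *ᵥ combination x) ≈ sum (λ i → μ i * g i * (x i * x i))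
    form-combination x = begin-equality
      w ∙ (A *ᵥ w)
        ≈⟨ ∙-cong {u = w} (λ _ → refl) A-combination ⟩
      w ∙ (λ j → sum λ i → x i * μ i * v i j)
        ≈⟨ ∙-∑ʳ w (λ i j → x i * μ i * v i j) ⟩
      sum (λ i → w ∙ (λ j → x i * μ i * v i j))
        ≈⟨ sum-cong-≋ (λ i → trans (∙-scaleʳ (x i * μ i) w (v i)) (trans
             (*-congˡ (trans (∙-comm w (v i)) (v∙combination i x)))
             (solve 3 (λ x m g → x :* m :* (x :* g) := m :* g :* (x :* x)) refl (x i) (μ i) (g i)))) ⟩
      sum (λ i → μ i * g i * (x i * x i)) ∎
      where
      w = combination x
      A-combination : ∀ j → (A *ᵥ w) j ≈ sum λ i → x i * μ i * v i j
      A-combination j = trans (∙-∑ʳ (A j) (λ i j → x i * v i j)) (sum-cong-≋ λ i →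
        trans (∙-scaleʳ (x i) (A j) (v i)) (trans (*-congˡ (eigen i j)) (sym (*-assoc (x i) (μ i) (v i j)))))

    module _ (ds : Vec Carrier n) (ℓ : Vector (Vector Carrier n) n)
             (ds≉0 : ∀ l → lookup ds l ≉ 0#)
             (ℓ-regular : ∀ w → (∀ l → ℓ l ∙ w ≈ 0#) → ∀ i → w i ≈ 0#)
             (A≈ : ∀ i j → A i j ≈ sum λ l → lookup ds l * (ℓ l i * ℓ l j)) where

      private
        d : Vector Carrier n
        d = lookup ds
        μs : Vec Carrier n
        μs = tabulate μ
        -- The functionals ℓ in coordinates with respect to the eigenvectors, so that the two
        -- diagonalisations become forms in the same variables.
        L : Vector (Vector Carrier n) n
        L l i = ℓ l ∙ v i

      form-decomposition : ∀ w → w ∙ (A *ᵥ w) ≈ sum (λ l → d l * ((ℓ l ∙ w) * (ℓ l ∙ w)))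
      form-decomposition w = begin-equality
        w ∙ (A *ᵥ w)
          ≈⟨ ∙-cong {u = w} (λ _ → refl) (λ i → trans (∙-comm (A i) w) (trans (∙-cong {u = w} (λ _ → refl) (A≈ i))
               (trans (∙-∑ʳ w (λ l j → d l * (ℓ l i * ℓ l j))) (sum-cong-≋ λ l → trans
                 (∙-cong {u = w} (λ _ → refl) (λ j → sym (*-assoc (d l) (ℓ l i) (ℓ l j)))) (trans
                   (∙-scaleʳ (d l * ℓ l i) w (ℓ l)) (trans (*-congˡ (∙-comm w (ℓ l)))
                     (solve 3 (λ d y z → d :* y :* z := d :* z :* y) refl (d l) (ℓ l i) (ℓ l ∙ w)))))))) ⟩
        w ∙ (λ i → sum λ l → d l * (ℓ l ∙ w) * ℓ l i)
          ≈⟨ ∙-∑ʳ w (λ l i → d l * (ℓ l ∙ w) * ℓ l i) ⟩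
        sum (λ l → w ∙ (λ i → d l * (ℓ l ∙ w) * ℓ l i))
          ≈⟨ sum-cong-≋ (λ l → trans (∙-scaleʳ (d l * (ℓ l ∙ w)) w (ℓ l)) (trans (*-congˡ (∙-comm w (ℓ l)))
               (*-assoc (d l) (ℓ l ∙ w) (ℓ l ∙ w)))) ⟩
        sum (λ l → d l * ((ℓ l ∙ w) * (ℓ l ∙ w))) ∎

      L∙x : ∀ l x → L l ∙ x ≈ ℓ l ∙ combination x
      L∙x l x = sym (trans (∙-∑ʳ (ℓ l) (λ i j → x i * v i j))
        (sum-cong-≋ λ i → trans (∙-scaleʳ (x i) (ℓ l) (v i)) (*-comm (x i) (ℓ l ∙ v i))))

      L-regular : ∀ x → (∀ l → L l ∙ x ≈ 0#) → ∀ i → x i ≈ 0#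
      L-regular x Lx≈0 i = a*x≈0⇒x≈0 (0<⇒≉0 (nonZero i)) (trans (*-comm (g i) (x i))
        (trans (sym (v∙combination i x)) (∙-zeroʳ (v i)
          (ℓ-regular (combination x) λ l → trans (sym (L∙x l x)) (Lx≈0 l)))))

      forms : ∀ x → sum (λ i → μ i * g i * (x i * x i)) ≈ sum (λ l → d l * ((L l ∙ x) * (L l ∙ x)))
      forms x = trans (sym (form-combination x)) (trans (form-decomposition (combination x))
        (sum-cong-≋ λ l → *-congˡ {d l} (*-cong (sym (L∙x l x)) (sym (L∙x l x)))))

      negated-forms : ∀ x → sum (λ i → - (μ i * g i) * (x i * x i)) ≈ sum (λ l → - d l * ((L l ∙ x) * (L l ∙ x)))
      negated-forms x = begin-equality
        sum (λ i → - (μ i * g i) * (x i * x i))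
          ≈⟨ sum-cong-≋ (λ i → solve 2 (λ a b → (:- a) :* b := :- (a :* b)) refl (μ i * g i) (x i * x i)) ⟩
        sum (λ i → - (μ i * g i * (x i * x i)))
          ≈⟨ trans (∑-neg (λ i → μ i * g i * (x i * x i))) (trans (-‿cong (forms x)) (sym (∑-neg λ l → d l * ((L l ∙ x) * (L l ∙ x))))) ⟩
        sum (λ l → - (d l * ((L l ∙ x) * (L l ∙ x))))
          ≈⟨ sum-cong-≋ (λ l → solve 2 (λ a b → :- (a :* b) := (:- a) :* b) refl (d l) ((L l ∙ x) * (L l ∙ x))) ⟩
        sum (λ l → - d l * ((L l ∙ x) * (L l ∙ x))) ∎

      -- Since no entry of `ds` vanishes, this means that there are at least as many negative
      -- eigenvalues as negative entries of `ds`.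
      n≤ν+pos : n ℕ.≤ count (_<? 0#) μs ℕ.+ count (0# <?_) ds
      n≤ν+pos = dimension-bound μs ds (_<? 0#) (0# <?_) (λ i → μ i * g i) d L
        (λ i μᵢ≮0 → 0≤x*y (≤-respʳ (reflexive (Vec.lookup∘tabulate μ i)) (≮⇒≥ μᵢ≮0)) (inj₁ (nonZero i)))
        (λ l 0≮dₗ → ≮⇒≥ 0≮dₗ) ds≉0 L-regular forms

      -- The same count for the form of -A, where the two signs trade places.
      n≤π+neg : n ℕ.≤ count (0# <?_) μs ℕ.+ count (_<? 0#) ds
      n≤π+neg = dimension-bound μs ds (0# <?_) (_<? 0#) (λ i → - (μ i * g i)) (-_ ∘ d) L
        (λ i 0≮μᵢ → ≤-respʳ (solve 2 (λ a b → (:- a) :* b := :- (a :* b)) refl (μ i) (g i))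
          (0≤x*y (x≤0⇒0≤-x (≤-trans (inj₂ (reflexive (≡.sym (Vec.lookup∘tabulate μ i)))) (≮⇒≥ 0≮μᵢ))) (inj₁ (nonZero i))))
        (λ l dₗ≮0 → 0≤-x⇒x≤0 (≤-respʳ (solve 1 (λ a → a := :- (:- a)) refl (d l)) (≮⇒≥ dₗ≮0)))
        (λ l -d≈0 → ds≉0 l (trans (solve 1 (λ a → a := :- (:- a)) refl (d l)) (trans (-‿cong -d≈0) -0#≈0#)))
        L-regular negated-forms

      isSpectrum : IsSpectrum ℝ A μs
      isSpectrum x = trans (charPoly-eigenframe x)
        (∏-cong λ i → +-congˡ {x} (-‿cong (reflexive (≡.sym (Vec.lookup∘tabulate μ i)))))

  -- Cancelling gives p ≤ π and q ≤ ν. As the totals agree, nothing is left for ξ and both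
  -- inequalities are equalities.
  squeeze : ∀ {π ξ ν p q} → π ℕ.+ (ξ ℕ.+ ν) ≡ p ℕ.+ q →
            p ℕ.+ q ℕ.≤ ν ℕ.+ p → p ℕ.+ q ℕ.≤ π ℕ.+ q → π ≡ p × ξ ≡ 0 × ν ≡ q
  squeeze {π} {ξ} {ν} {p} {q} total p+q≤ν+p p+q≤π+q = π≡p , ξ≡0 , ν≡q
    where
    p≤π : p ℕ.≤ π
    p≤π = ℕ.+-cancelʳ-≤ q p π p+q≤π+q
    q≤ν : q ℕ.≤ ν
    q≤ν = ℕ.+-cancelʳ-≤ p q ν (ℕ.≤-trans (ℕ.≤-reflexive (ℕ.+-comm q p)) p+q≤ν+p)
    ξ≡0 : ξ ≡ 0
    ξ≡0 = ℕ.n≤0⇒n≡0 (ℕ.+-cancelʳ-≤ (p ℕ.+ q) ξ 0 (ℕ.≤-trans (ℕ.+-monoʳ-≤ ξ (ℕ.+-mono-≤ p≤π q≤ν))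
      (ℕ.≤-reflexive (≡.trans (≡.trans (≡.sym (ℕ.+-assoc ξ π ν)) (≡.trans (≡.cong (ℕ._+ ν) (ℕ.+-comm ξ π)) (ℕ.+-assoc π ξ ν))) total))))
    π+ν≡p+q : π ℕ.+ ν ≡ p ℕ.+ q
    π+ν≡p+q = ≡.trans (≡.cong (λ ξ → π ℕ.+ (ξ ℕ.+ ν)) (≡.sym ξ≡0)) total
    π≡p : π ≡ p
    π≡p = ℕ.≤-antisym (ℕ.+-cancelʳ-≤ q π p (ℕ.≤-trans (ℕ.+-monoʳ-≤ π q≤ν) (ℕ.≤-reflexive π+ν≡p+q))) p≤π
    ν≡q : ν ≡ q
    ν≡q = ℕ.+-cancelˡ-≡ p ν q (≡.trans (≡.cong (ℕ._+ ν) (≡.sym π≡p)) π+ν≡p+q)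

  hasInertia : ∀ {n} {A : Matrix ℝ n} → Symmetric A → (ds : Vec Carrier n) (ℓ : Vector (Vector Carrier n) n) →
               (∀ l → lookup ds l ≉ 0#) → (∀ w → (∀ l → ℓ l ∙ w ≈ 0#) → ∀ i → w i ≈ 0#) →
               (∀ i j → A i j ≈ sum λ l → lookup ds l * (ℓ l i * ℓ l j)) →
               HasInertia ℝ A (count (0# <?_) ds , 0 , count (_<? 0#) ds)
  hasInertia {n} {A} A-sym ds ℓ ds≉0 ℓ-regular A≈ =
    tabulate (Eigenframe.value frame) , isSpectrum frame ds ℓ ds≉0 ℓ-regular A≈ ,
    squeeze (≡.trans (count-trichotomy (tabulate (Eigenframe.value frame))) n≡)
      (ℕ.≤-trans (ℕ.≤-reflexive (≡.sym n≡)) (n≤ν+pos frame ds ℓ ds≉0 ℓ-regular A≈))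
      (ℕ.≤-trans (ℕ.≤-reflexive (≡.sym n≡)) (n≤π+neg frame ds ℓ ds≉0 ℓ-regular A≈))
    where
    frame : Eigenframe A n
    frame = eigenframe A-sym n ℕ.≤-refl
    n≡ : n ≡ count (0# <?_) ds ℕ.+ count (_<? 0#) ds
    n≡ = ≡.trans (≡.sym (count-trichotomy ds))
      (≡.cong (λ z → count (0# <?_) ds ℕ.+ (z ℕ.+ count (_<? 0#) ds)) (count-zero ds ds≉0))

-- The factorisation of the beta matrix and the signs of its diagonal part.

module BetaDecomposition {c ℓ₁ ℓ₂ : Level} (ℝ : Reals c ℓ₁ ℓ₂) where

  open RealArithmetic ℝ
  open LinearAlgebra ℝ
  open Spectral ℝ
  open Inertia ℝ
  open import Algebra.Properties.Semiring.Mult semiring using (×-homo-+; ×1-homo-*)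

  private
    ⟦_⟧ : ℕ → Carrier
    ⟦_⟧ = fromℕ ℝ

  ⟦+⟧ : ∀ m n → ⟦ m ℕ.+ n ⟧ ≈ ⟦ m ⟧ + ⟦ n ⟧
  ⟦+⟧ m n = ×-homo-+ 1# m n

  ⟦*⟧ : ∀ m n → ⟦ m ℕ.* n ⟧ ≈ ⟦ m ⟧ * ⟦ n ⟧
  ⟦*⟧ = ×1-homo-*

  0≤⟦n⟧ : ∀ n → 0# ≤ ⟦ n ⟧
  0≤⟦n⟧ zero    = ≤-refl
  0≤⟦n⟧ (suc n) = 0≤x+y (inj₁ 0<1) (0≤⟦n⟧ n)

  0<⟦suc⟧ : ∀ n → 0# < ⟦ suc n ⟧
  0<⟦suc⟧ n = 0<x+y 0<1 (0≤⟦n⟧ n)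

  ⟦suc⟧≉0 : ∀ n → ⟦ suc n ⟧ ≉ 0#
  ⟦suc⟧≉0 n = 0<⇒≉0 (0<⟦suc⟧ n)

  ⟦!⟧≉0 : ∀ n → ⟦ n ! ⟧ ≉ 0#
  ⟦!⟧≉0 zero    = ⟦suc⟧≉0 0
  ⟦!⟧≉0 (suc n) n!≈0 = a*x≉0 (⟦suc⟧≉0 n) (⟦!⟧≉0 n) (trans (sym (⟦*⟧ (suc n) (n !))) n!≈0)

  -- ℓ i m = (i !)² / ((i - m)! (i + m + 1)!), extended by zero to m > i.
  ℓ : ℕ → ℕ → Carrier
  ℓ i zero    = ⟦ suc i ⟧ ⁻¹
  ℓ i (suc m) = ℓ i m * ((⟦ i ⟧ - ⟦ m ⟧) * ⟦ suc (suc (i ℕ.+ m)) ⟧ ⁻¹)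

  ℓ-zero : ∀ i → (1# + ⟦ i ⟧) * ℓ i 0 ≈ 1#
  ℓ-zero i = *-inverseʳ _ (⟦suc⟧≉0 i)

  ℓ-suc : ∀ i m → (2# + ⟦ i ⟧ + ⟦ m ⟧) * ℓ i (suc m) ≈ (⟦ i ⟧ - ⟦ m ⟧) * ℓ i m
  ℓ-suc i m = begin-equality
    (2# + ⟦ i ⟧ + ⟦ m ⟧) * (ℓ i m * ((⟦ i ⟧ - ⟦ m ⟧) * k ⁻¹))
      ≈⟨ *-congʳ (trans (solve 2 (λ i m → con (ℤ.+ 2) :+ i :+ m := con (ℤ.+ 1) :+ (con (ℤ.+ 1) :+ (i :+ m))) refl ⟦ i ⟧ ⟦ m ⟧)
           (+-congˡ (+-congˡ (sym (⟦+⟧ i m))))) ⟩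
    k * (ℓ i m * ((⟦ i ⟧ - ⟦ m ⟧) * k ⁻¹))
      ≈⟨ solve 4 (λ k a b k⁻¹ → k :* (a :* (b :* k⁻¹)) := k :* k⁻¹ :* (b :* a)) refl k (ℓ i m) (⟦ i ⟧ - ⟦ m ⟧) (k ⁻¹) ⟩
    k * k ⁻¹ * ((⟦ i ⟧ - ⟦ m ⟧) * ℓ i m)
      ≈⟨ trans (*-congʳ (*-inverseʳ k (⟦suc⟧≉0 (suc (i ℕ.+ m))))) (*-identityˡ _) ⟩
    (⟦ i ⟧ - ⟦ m ⟧) * ℓ i m ∎
    where k = ⟦ suc (suc (i ℕ.+ m)) ⟧

  -- The factor i - m in the recursion vanishes at m = i, and from there on every value is a
  -- multiple of zero.
  i<m⇒ℓ≈0 : ∀ {i m} → i ℕ.< m → ℓ i m ≈ 0#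
  i<m⇒ℓ≈0 {i} {suc m} (s≤s i≤m) with ℕ.m≤n⇒m<n∨m≡n i≤m
  ... | inj₁ i<m    = trans (*-congʳ (i<m⇒ℓ≈0 i<m)) (zeroˡ _)
  ... | inj₂ ≡.refl = trans (*-congˡ (trans (*-congʳ (-‿inverseʳ ⟦ i ⟧)) (zeroˡ _))) (zeroʳ _)

  m≤i⇒ℓ≉0 : ∀ {i m} → m ℕ.≤ i → ℓ i m ≉ 0#
  m≤i⇒ℓ≉0 {i} {zero}  _   = 0<⇒≉0 (0<x⁻¹ (0<⟦suc⟧ i))
  m≤i⇒ℓ≉0 {i} {suc m} m<i = a*x≉0 (m≤i⇒ℓ≉0 (ℕ.<⇒≤ m<i))
    (a*x≉0 (i-m≉0 m<i) (0<⇒≉0 (0<x⁻¹ (0<⟦suc⟧ (suc (i ℕ.+ m))))))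
    where
    i-m≉0 : ∀ {i m} → m ℕ.< i → ⟦ i ⟧ - ⟦ m ⟧ ≉ 0#
    i-m≉0 {suc i} {zero}  _         eq = ⟦suc⟧≉0 i (trans (solve 1 (λ x → x := x :- con (ℤ.+ 0)) refl ⟦ suc i ⟧) eq)
    i-m≉0 {suc i} {suc m} (s≤s m<i) eq = i-m≉0 m<i
      (trans (solve 2 (λ x y → x :- y := (con (ℤ.+ 1) :+ x) :- (con (ℤ.+ 1) :+ y)) refl ⟦ i ⟧ ⟦ m ⟧) eq)

  2+j+m≉0 : ∀ j m → 2# + ⟦ j ⟧ + ⟦ m ⟧ ≉ 0#
  2+j+m≉0 j m = 0<⇒≉0 (0<x+y (0<x+y (0<x+y 0<1 (inj₁ 0<1)) (0≤⟦n⟧ j)) (0≤⟦n⟧ m))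

  -- The ratio of neighbouring values in the first argument, multiplied out so that it stays valid
  -- for m > j, where both sides are zero. As ℓ is defined by recursion on m, so is the proof.
  ℓ-shift : ∀ j m → ⟦ suc j ⟧ * ⟦ suc j ⟧ * ℓ j m ≈ (⟦ suc j ⟧ - ⟦ m ⟧) * (2# + ⟦ j ⟧ + ⟦ m ⟧) * ℓ (suc j) m
  ℓ-shift j zero = begin-equality
    ⟦ suc j ⟧ * ⟦ suc j ⟧ * ℓ j 0
      ≈⟨ trans (*-assoc _ _ _) (trans (*-congˡ (ℓ-zero j)) (sym (*-congˡ (ℓ-zero (suc j))))) ⟩
    ⟦ suc j ⟧ * ((1# + ⟦ suc j ⟧) * ℓ (suc j) 0)
      ≈⟨ solve 2 (λ j a → (con (ℤ.+ 1) :+ j) :* ((con (ℤ.+ 1) :+ (con (ℤ.+ 1) :+ j)) :* a)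
           := (con (ℤ.+ 1) :+ j :- con (ℤ.+ 0)) :* (con (ℤ.+ 2) :+ j :+ con (ℤ.+ 0)) :* a) refl ⟦ j ⟧ (ℓ (suc j) 0) ⟩
    (⟦ suc j ⟧ - 0#) * (2# + ⟦ j ⟧ + 0#) * ℓ (suc j) 0 ∎
  ℓ-shift j (suc m) = *-cancelˡ (2+j+m≉0 j m) (begin-equality
    (2# + J + M) * ((1# + J) * (1# + J) * ℓ j (suc m))
      ≈⟨ solve 3 (λ j k a → k :* ((con (ℤ.+ 1) :+ j) :* (con (ℤ.+ 1) :+ j) :* a)
           := (con (ℤ.+ 1) :+ j) :* (con (ℤ.+ 1) :+ j) :* (k :* a)) refl J (2# + J + M) (ℓ j (suc m)) ⟩
    (1# + J) * (1# + J) * ((2# + J + M) * ℓ j (suc m))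
      ≈⟨ *-congˡ (ℓ-suc j m) ⟩
    (1# + J) * (1# + J) * ((J - M) * ℓ j m)
      ≈⟨ solve 3 (λ j b a → (con (ℤ.+ 1) :+ j) :* (con (ℤ.+ 1) :+ j) :* (b :* a)
           := b :* ((con (ℤ.+ 1) :+ j) :* (con (ℤ.+ 1) :+ j) :* a)) refl J (J - M) (ℓ j m) ⟩
    (J - M) * ((1# + J) * (1# + J) * ℓ j m)
      ≈⟨ *-congˡ (ℓ-shift j m) ⟩
    (J - M) * ((1# + J - M) * (2# + J + M) * ℓ (suc j) m)
      ≈⟨ solve 4 (λ b d k a → b :* (d :* k :* a) := k :* b :* (d :* a)) refl (J - M) (1# + J - M) (2# + J + M) (ℓ (suc j) m) ⟩
    (2# + J + M) * (J - M) * ((1# + J - M) * ℓ (suc j) m)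
      ≈⟨ *-congˡ (ℓ-suc (suc j) m) ⟨
    (2# + J + M) * (J - M) * ((2# + (1# + J) + M) * ℓ (suc j) (suc m))
      ≈⟨ solve 3 (λ j m a → (con (ℤ.+ 2) :+ j :+ m) :* (j :- m) :* ((con (ℤ.+ 2) :+ (con (ℤ.+ 1) :+ j) :+ m) :* a)
           := (con (ℤ.+ 2) :+ j :+ m) :* ((con (ℤ.+ 1) :+ j :- (con (ℤ.+ 1) :+ m)) :* (con (ℤ.+ 2) :+ j :+ (con (ℤ.+ 1) :+ m)) :* a))
           refl J M (ℓ (suc j) (suc m)) ⟩
    (2# + J + M) * ((1# + J - (1# + M)) * (2# + J + (1# + M)) * ℓ (suc j) (suc m)) ∎)
    where
    J = ⟦ j ⟧
    M = ⟦ m ⟧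

  alternatingSign : ℕ → Carrier
  alternatingSign zero    = 1#
  alternatingSign (suc m) = - alternatingSign m

  2m+1 : ℕ → Carrier
  2m+1 m = 1# + 2# * ⟦ m ⟧

  -- The reciprocal of the squared norm of the m-th Bessel polynomial with constant term 1, for the
  -- moments 1/(n + 1)!. Correspondingly `ℓ i m` is i! times the pairing of this polynomial with the
  -- i-th power.
  d : ℕ → Carrier
  d m = alternatingSign m * 2m+1 m

  term : ℕ → ℕ → ℕ → Carrier
  term i j m = d m * (ℓ i m * ℓ j m)

  -- The factors are grouped such that at m + 1 each bracket is the left side of an instance of
  -- `ℓ-suc`. Together with `ℓ-shift`, this makes everything in `telescoping` a multiple of ℓ i m ℓ
  -- (j + 1) m and leaves a polynomial identity in i, j and m.
  certificate : ℕ → ℕ → ℕ → Carrier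
  certificate i j m = - (alternatingSign m * ⟦ m ⟧ * ((1# + ⟦ i ⟧ + ⟦ m ⟧) * ℓ i m) * ((2# + ⟦ j ⟧ + ⟦ m ⟧) * ℓ (suc j) m))

  -- Zeilberger's method, giving a recurrence in j for the sum of term i j m over m.
  telescoping : ∀ i j m → (1# + ⟦ j ⟧) * (2# + ⟦ i ⟧ + ⟦ j ⟧) * term i (suc j) m - (1# + ⟦ j ⟧) * (1# + ⟦ j ⟧) * term i j m
                          ≈ certificate i j (suc m) - certificate i j m
  telescoping i j m = begin-equality
    (1# + J) * (2# + I + J) * (s * (1# + 2# * M) * (a * h)) - (1# + J) * (1# + J) * (s * (1# + 2# * M) * (a * ℓ j m))
      ≈⟨ solve 7 (λ i j m s a h b → (con (ℤ.+ 1) :+ j) :* (con (ℤ.+ 2) :+ i :+ j) :* (s :* (con (ℤ.+ 1) :+ con (ℤ.+ 2) :* m) :* (a :* h))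
             :- (con (ℤ.+ 1) :+ j) :* (con (ℤ.+ 1) :+ j) :* (s :* (con (ℤ.+ 1) :+ con (ℤ.+ 2) :* m) :* (a :* b))
           := s :* (con (ℤ.+ 1) :+ con (ℤ.+ 2) :* m) :* a :* ((con (ℤ.+ 1) :+ j) :* (con (ℤ.+ 2) :+ i :+ j) :* h
             :- (con (ℤ.+ 1) :+ j) :* (con (ℤ.+ 1) :+ j) :* b)) refl I J M s a h (ℓ j m) ⟩
    s * (1# + 2# * M) * a * ((1# + J) * (2# + I + J) * h - (1# + J) * (1# + J) * ℓ j m)
      ≈⟨ *-congˡ (+-congˡ (-‿cong (ℓ-shift j m))) ⟩
    s * (1# + 2# * M) * a * ((1# + J) * (2# + I + J) * h - (1# + J - M) * (2# + J + M) * h)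
      ≈⟨ solve 6 (λ i j m s a h → s :* (con (ℤ.+ 1) :+ con (ℤ.+ 2) :* m) :* a :* ((con (ℤ.+ 1) :+ j) :* (con (ℤ.+ 2) :+ i :+ j) :* h
             :- (con (ℤ.+ 1) :+ j :- m) :* (con (ℤ.+ 2) :+ j :+ m) :* h)
           := :- (:- s :* (con (ℤ.+ 1) :+ m) :* ((i :- m) :* a) :* ((con (ℤ.+ 1) :+ j :- m) :* h))
             :- :- (s :* m :* ((con (ℤ.+ 1) :+ i :+ m) :* a) :* ((con (ℤ.+ 2) :+ j :+ m) :* h))) refl I J M s a h ⟩
    - (- s * (1# + M) * ((I - M) * a) * ((1# + J - M) * h)) - certificate i j m
      ≈⟨ +-congʳ (-‿cong (*-cong (*-congˡ (trans (sym (ℓ-suc i m)) (*-congʳ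
           (solve 2 (λ i m → con (ℤ.+ 2) :+ i :+ m := con (ℤ.+ 1) :+ i :+ (con (ℤ.+ 1) :+ m)) refl I M))))
           (trans (sym (ℓ-suc (suc j) m)) (*-congʳ
           (solve 2 (λ j m → con (ℤ.+ 2) :+ (con (ℤ.+ 1) :+ j) :+ m := con (ℤ.+ 2) :+ j :+ (con (ℤ.+ 1) :+ m)) refl J M))))) ⟩
    certificate i j (suc m) - certificate i j m ∎
    where
    I = ⟦ i ⟧
    J = ⟦ j ⟧
    M = ⟦ m ⟧
    s = alternatingSign m
    a = ℓ i m
    h = ℓ (suc j) m

  ∑-telescope : ∀ n (f : ℕ → Carrier) → sum {n} (λ m → f (suc (toℕ m)) - f (toℕ m)) ≈ f n - f 0
  ∑-telescope zero    f = sym (-‿inverseʳ (f 0))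
  ∑-telescope (suc n) f = trans (+-congˡ (∑-telescope n (f ∘ suc)))
    (solve 3 (λ a b x → (b :- a) :+ (x :- b) := x :- a) refl (f 0) (f 1) (f (suc n)))

  ∑term : ℕ → ℕ → ℕ → Carrier
  ∑term n i j = sum {n} λ m → term i j (toℕ m)

  -- The recurrence of i! j! / (i + j + 1)! in j. Summing `telescoping` over m gives it with an
  -- extra factor j + 1, which is cancelled.
  ∑term-suc : ∀ {n i} j → i ℕ.< n → (2# + ⟦ i ⟧ + ⟦ j ⟧) * ∑term n i (suc j) ≈ ⟦ suc j ⟧ * ∑term n i j
  ∑term-suc {n} {i} j i<n = *-cancelˡ (⟦suc⟧≉0 j) (begin-equality
    J * (K * ∑term n i (suc j))
      ≈⟨ solve 4 (λ j k x y → j :* (k :* x) := (j :* k :* x :- j :* j :* y) :+ j :* (j :* y)) refl J K (∑term n i (suc j)) (∑term n i j) ⟩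
    (J * K * ∑term n i (suc j) - J * J * ∑term n i j) + J * (J * ∑term n i j)
      ≈⟨ +-congʳ difference ⟩
    0# + J * (J * ∑term n i j)
      ≈⟨ +-identityˡ _ ⟩
    J * (J * ∑term n i j) ∎)
    where
    J = ⟦ suc j ⟧
    K = 2# + ⟦ i ⟧ + ⟦ j ⟧
    H = certificate i j
    difference : J * K * ∑term n i (suc j) - J * J * ∑term n i j ≈ 0#
    difference = begin-equality
      J * K * ∑term n i (suc j) - J * J * ∑term n i j
        ≈⟨ +-cong (*-distribˡ-sum (J * K) (λ (m : Fin n) → term i (suc j) (toℕ m)))
             (-‿cong (*-distribˡ-sum (J * J) (λ (m : Fin n) → term i j (toℕ m)))) ⟩
      sum {n} (λ m → J * K * term i (suc j) (toℕ m)) - sum {n} (λ m → J * J * term i j (toℕ m))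
        ≈⟨ ∑-distrib-- {n} (λ m → J * K * term i (suc j) (toℕ m)) (λ m → J * J * term i j (toℕ m)) ⟨
      sum {n} (λ m → J * K * term i (suc j) (toℕ m) - J * J * term i j (toℕ m))
        ≈⟨ sum-cong-≋ {n} (λ m → telescoping i j (toℕ m)) ⟩
      sum {n} (λ m → H (suc (toℕ m)) - H (toℕ m))
        ≈⟨ ∑-telescope n H ⟩
      H n - H 0
        -- Both boundary terms vanish: the upper one because ℓ i n = 0 for n > i, the lower one
        -- through its factor m = 0.
        ≈⟨ +-congʳ (-‿cong (*-congʳ (*-congˡ (trans (*-congˡ (i<m⇒ℓ≈0 i<n)) (zeroʳ _))))) ⟩
      - (alternatingSign n * ⟦ n ⟧ * 0# * ((2# + ⟦ j ⟧ + ⟦ n ⟧) * ℓ (suc j) n)) - H 0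
        ≈⟨ solve 4 (λ s x y z → :- (s :* con (ℤ.+ 0) :* x) :- :- (con (ℤ.+ 1) :* con (ℤ.+ 0) :* y :* z) := con (ℤ.+ 0)) refl
             (alternatingSign n * ⟦ n ⟧) ((2# + ⟦ j ⟧ + ⟦ n ⟧) * ℓ (suc j) n)
             ((1# + ⟦ i ⟧ + ⟦ 0 ⟧) * ℓ i 0) ((2# + ⟦ j ⟧ + ⟦ 0 ⟧) * ℓ (suc j) 0) ⟩
      0# ∎

  ∑term-zero : ∀ {n} i → 0 ℕ.< n → (1# + ⟦ i ⟧) * ∑term n i 0 ≈ 1#
  ∑term-zero {suc n} i _ = begin-equality
    (1# + ⟦ i ⟧) * ∑term (suc n) i 0
      -- For j = 0 only m = 0 contributes, as ℓ 0 m = 0 for m > 0.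
      ≈⟨ *-congˡ (∑-single {suc n} {λ m → term i 0 (toℕ m)} zero λ where
           zero    0≢0 → ⊥-elim (0≢0 ≡.refl)
           (suc m) _   → trans (*-congˡ (trans (*-congˡ (i<m⇒ℓ≈0 {0} {suc (toℕ m)} (s≤s z≤n))) (zeroʳ _))) (zeroʳ _)) ⟩
    (1# + ⟦ i ⟧) * (1# * (1# + 2# * 0#) * (ℓ i 0 * ℓ 0 0))
      ≈⟨ solve 3 (λ k x y → k :* (con (ℤ.+ 1) :* (con (ℤ.+ 1) :+ con (ℤ.+ 2) :* con (ℤ.+ 0)) :* (x :* y))
           := k :* x :* ((con (ℤ.+ 1) :+ con (ℤ.+ 0)) :* y)) refl (1# + ⟦ i ⟧) (ℓ i 0) (ℓ 0 0) ⟩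
    (1# + ⟦ i ⟧) * ℓ i 0 * ((1# + 0#) * ℓ 0 0)
      ≈⟨ *-cong (ℓ-zero i) (ℓ-zero 0) ⟩
    1# * 1#
      ≈⟨ *-identityˡ 1# ⟩
    1# ∎

  ∑term-factorials : ∀ {n i} j → i ℕ.< n → ⟦ (i ℕ.+ suc j) ! ⟧ * ∑term n i j ≈ ⟦ i ! ⟧ * ⟦ j ! ⟧
  ∑term-factorials {n} {i} zero i<n = begin-equality
    ⟦ (i ℕ.+ 1) ! ⟧ * ∑term n i 0
      ≈⟨ *-congʳ (trans (reflexive (≡.cong (λ k → ⟦ k ! ⟧) (ℕ.+-comm i 1))) (⟦*⟧ (suc i) (i !))) ⟩
    ⟦ suc i ⟧ * ⟦ i ! ⟧ * ∑term n i 0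
      ≈⟨ solve 3 (λ a b x → a :* b :* x := b :* (a :* x)) refl ⟦ suc i ⟧ ⟦ i ! ⟧ (∑term n i 0) ⟩
    ⟦ i ! ⟧ * (⟦ suc i ⟧ * ∑term n i 0)
      ≈⟨ *-congˡ (trans (∑term-zero i (ℕ.≤-<-trans z≤n i<n)) (sym (+-identityʳ 1#))) ⟩
    ⟦ i ! ⟧ * ⟦ 0 ! ⟧ ∎
  ∑term-factorials {n} {i} (suc j) i<n = begin-equality
    ⟦ (i ℕ.+ suc (suc j)) ! ⟧ * ∑term n i (suc j)
      ≈⟨ *-congʳ (trans (reflexive (≡.cong (λ k → ⟦ k ! ⟧) (ℕ.+-suc i (suc j)))) (⟦*⟧ (suc k) (k !))) ⟩
    ⟦ suc k ⟧ * ⟦ k ! ⟧ * ∑term n i (suc j)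
      ≈⟨ *-congʳ (*-congʳ (trans (+-congˡ (⟦+⟧ i (suc j)))
           (solve 2 (λ i j → con (ℤ.+ 1) :+ (i :+ (con (ℤ.+ 1) :+ j)) := con (ℤ.+ 2) :+ i :+ j) refl ⟦ i ⟧ ⟦ j ⟧))) ⟩
    (2# + ⟦ i ⟧ + ⟦ j ⟧) * ⟦ k ! ⟧ * ∑term n i (suc j)
      ≈⟨ solve 3 (λ a b x → a :* b :* x := b :* (a :* x)) refl (2# + ⟦ i ⟧ + ⟦ j ⟧) ⟦ k ! ⟧ (∑term n i (suc j)) ⟩
    ⟦ k ! ⟧ * ((2# + ⟦ i ⟧ + ⟦ j ⟧) * ∑term n i (suc j))
      ≈⟨ *-congˡ (∑term-suc j i<n) ⟩
    ⟦ k ! ⟧ * (⟦ suc j ⟧ * ∑term n i j)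
      ≈⟨ solve 3 (λ a b x → a :* (b :* x) := b :* (a :* x)) refl ⟦ k ! ⟧ ⟦ suc j ⟧ (∑term n i j) ⟩
    ⟦ suc j ⟧ * (⟦ k ! ⟧ * ∑term n i j)
      ≈⟨ *-congˡ (∑term-factorials j i<n) ⟩
    ⟦ suc j ⟧ * (⟦ i ! ⟧ * ⟦ j ! ⟧)
      ≈⟨ solve 3 (λ a b x → a :* (b :* x) := b :* (a :* x)) refl ⟦ suc j ⟧ ⟦ i ! ⟧ ⟦ j ! ⟧ ⟩
    ⟦ i ! ⟧ * (⟦ suc j ⟧ * ⟦ j ! ⟧)
      ≈⟨ *-congˡ (⟦*⟧ (suc j) (j !)) ⟨
    ⟦ i ! ⟧ * ⟦ suc j ! ⟧ ∎
    where k = i ℕ.+ suc j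

  β-decomposition : ∀ {n i} j → i ℕ.< n → β ℝ (suc i) (suc j) ≈ ∑term n i j
  β-decomposition {n} {i} j i<n = *-cancelˡ (⟦!⟧≉0 k) (begin-equality
    ⟦ k ! ⟧ * (⟦ i ! ⟧ * ⟦ j ! ⟧ * ⟦ k ! ⟧ ⁻¹)
      ≈⟨ solve 3 (λ a b a⁻¹ → a :* (b :* a⁻¹) := a :* a⁻¹ :* b) refl ⟦ k ! ⟧ (⟦ i ! ⟧ * ⟦ j ! ⟧) (⟦ k ! ⟧ ⁻¹) ⟩
    ⟦ k ! ⟧ * ⟦ k ! ⟧ ⁻¹ * (⟦ i ! ⟧ * ⟦ j ! ⟧)
      ≈⟨ trans (*-congʳ (*-inverseʳ _ (⟦!⟧≉0 k))) (*-identityˡ _) ⟩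
    ⟦ i ! ⟧ * ⟦ j ! ⟧
      ≈⟨ ∑term-factorials j i<n ⟨
    ⟦ k ! ⟧ * ∑term n i j ∎)
    where k = i ℕ.+ suc j

  -- Back substitution: without its first row and column the system is of the same kind and kills
  -- the tail of w, after which the first equation kills the head.
  triangular-regular : ∀ {n} (T : Vector (Vector Carrier n) n) →
                       (∀ {l i} → toℕ i ℕ.< toℕ l → T l i ≈ 0#) → (∀ i → T i i ≉ 0#) →
                       ∀ w → (∀ l → T l ∙ w ≈ 0#) → ∀ i → w i ≈ 0#
  triangular-regular {suc n} T lower≈0 diagonal≉0 w Tw≈0 = λ where
      zero    → a*x≈0⇒x≈0 (diagonal≉0 zero) (trans (sym (+-identityʳ _))
        (trans (+-congˡ (sym (∙-zeroʳ (T zero ∘ suc) tail≈0))) (Tw≈0 zero)))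
      (suc i) → tail≈0 i
    where
    tail≈0 : ∀ i → w (suc i) ≈ 0#
    tail≈0 = triangular-regular (λ l → T (suc l) ∘ suc) (lower≈0 ∘ s≤s) (diagonal≉0 ∘ suc) (w ∘ suc) λ l →
      trans (sym (+-identityˡ _)) (trans (+-congʳ (sym (trans
        (*-congʳ (lower≈0 {suc l} {zero} (s≤s z≤n))) (zeroˡ _)))) (Tw≈0 (suc l)))

  Alternates : (ℕ → Carrier) → Set ℓ₂
  Alternates f = ∀ m → (0# < f m → f (suc m) < 0#) × (f m < 0# → 0# < f (suc m))

  mutual
    -- The sign of the first entry receives the larger half. Dropping that entry exchanges the
    -- signs, and the halves follow by computation: ⌈ suc n /2⌉ is suc ⌊ n /2⌋, and ⌊ suc n /2⌋ is ⌈
    -- n /2⌉.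
    count-alternating⁺ : ∀ n {f} → Alternates f → 0# < f 0 → let fs = tabulate {n = n} (f ∘ toℕ) in
                         count (0# <?_) fs ≡ ⌈ n /2⌉ × count (_<? 0#) fs ≡ ⌊ n /2⌋
    count-alternating⁺ zero        alt 0<f₀ = ≡.refl , ≡.refl
    count-alternating⁺ (suc n) {f} alt 0<f₀ with 0# <? f 0 | f 0 <? 0# | count-alternating⁻ n (alt ∘ suc) (proj₁ (alt 0) 0<f₀)
    ... | yes _    | no  _    | pos , neg = ≡.cong suc pos , neg
    ... | no  0≮f₀ | _        | _         = ⊥-elim (0≮f₀ 0<f₀)
    ... | yes _    | yes f₀<0 | _         = ⊥-elim (<⇒≱ 0<f₀ (inj₁ f₀<0))

    count-alternating⁻ : ∀ n {f} → Alternates f → f 0 < 0# → let fs = tabulate {n = n} (f ∘ toℕ) in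
                         count (0# <?_) fs ≡ ⌊ n /2⌋ × count (_<? 0#) fs ≡ ⌈ n /2⌉
    count-alternating⁻ zero        alt f₀<0 = ≡.refl , ≡.refl
    count-alternating⁻ (suc n) {f} alt f₀<0 with 0# <? f 0 | f 0 <? 0# | count-alternating⁺ n (alt ∘ suc) (proj₂ (alt 0) f₀<0)
    ... | no  _    | yes _    | pos , neg = pos , ≡.cong suc neg
    ... | _        | no  f₀≮0 | _         = ⊥-elim (f₀≮0 f₀<0)
    ... | yes 0<f₀ | yes _    | _         = ⊥-elim (<⇒≱ 0<f₀ (inj₁ f₀<0))

  0<2m+1 : ∀ m → 0# < 2m+1 m
  0<2m+1 m = 0<x+y 0<1 (0≤x*y (0≤x+y (inj₁ 0<1) (inj₁ 0<1)) (0≤⟦n⟧ m))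

  0<x*y⇒0<x : ∀ {x y} → 0# < y → 0# < x * y → 0# < x
  0<x*y⇒0<x {x} {y} 0<y 0<xy = 0≤∧≉0⇒0< (*-cancelˡ-0≤ 0<y (inj₁ (<-respʳ (*-comm x y) 0<xy)))
    (λ x≈0 → 0<⇒≉0 0<xy (trans (*-congʳ x≈0) (zeroˡ y)))

  d-alternates : Alternates d
  d-alternates m =
      (λ 0<d → 0<-x⇒x<0 (<-respʳ (solve 2 (λ s p → s :* p := :- (:- s :* p)) refl s (2m+1 (suc m)))
        (*-positive (0<x*y⇒0<x (0<2m+1 m) 0<d) (0<2m+1 (suc m)))))
    , (λ d<0 → *-positive (0<x*y⇒0<x (0<2m+1 m)
        (<-respʳ (solve 2 (λ s p → :- (s :* p) := :- s :* p) refl s (2m+1 m)) (x<0⇒0<-x d<0))) (0<2m+1 (suc m)))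
    where s = alternatingSign m

  d≉0 : ∀ m → d m ≉ 0#
  d≉0 m = a*x≉0 (sign≉0 m) (0<⇒≉0 (0<2m+1 m))
    where
    sign≉0 : ∀ m → alternatingSign m ≉ 0#
    sign≉0 zero    = 0<⇒≉0 0<1
    sign≉0 (suc m) eq = sign≉0 m (trans (solve 1 (λ s → s := :- (:- s)) refl (alternatingSign m)) (trans (-‿cong eq) -0#≈0#))

  betaMatrix-symmetric : ∀ n → Symmetric (betaMatrix ℝ n)
  betaMatrix-symmetric n i j = *-cong (*-comm _ _)
    (reflexive (≡.cong (λ k → ⟦ k ! ⟧ ⁻¹) (≡.trans (ℕ.+-suc (toℕ i) (toℕ j))
      (≡.trans (≡.cong suc (ℕ.+-comm (toℕ i) (toℕ j))) (≡.sym (ℕ.+-suc (toℕ j) (toℕ i)))))))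

  betaMatrix-inertia : ∀ n → HasInertia ℝ (betaMatrix ℝ n) (⌈ n /2⌉ , 0 , ⌊ n /2⌋)
  betaMatrix-inertia n = ≡.subst₂ (λ p q → HasInertia ℝ (betaMatrix ℝ n) (p , 0 , q)) (proj₁ counts) (proj₂ counts)
    -- The l-th functional is the l-th column of ℓ, so its matrix is the transpose of ℓ and hence
    -- upper triangular.
    (hasInertia (betaMatrix-symmetric n) ds (λ l i → ℓ (toℕ i) (toℕ l))
      (λ l → d≉0 (toℕ l) ∘ trans (reflexive (≡.sym (lookup-ds l))))
      (triangular-regular (λ l i → ℓ (toℕ i) (toℕ l)) i<m⇒ℓ≈0 (λ i → m≤i⇒ℓ≉0 {toℕ i} ℕ.≤-refl))
      (λ i j → trans (β-decomposition (toℕ j) (Fin.toℕ<n i))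
        (sum-cong-≋ λ l → *-congʳ (reflexive (≡.sym (lookup-ds l))))))
    where
    ds : Vec Carrier n
    ds = tabulate (d ∘ toℕ)
    lookup-ds : ∀ l → lookup ds l ≡ d (toℕ l)
    lookup-ds = Vec.lookup∘tabulate (d ∘ toℕ)
    counts : count (0# <?_) ds ≡ ⌈ n /2⌉ × count (_<? 0#) ds ≡ ⌊ n /2⌋
    counts = count-alternating⁺ n d-alternates
      (<-respʳ (sym (*-identityˡ _)) (0<2m+1 0))

-- Halving even and odd numbers, and the theorem.

⌊n*2/2⌋≡n : ∀ n → ⌊ n ℕ.* 2 /2⌋ ≡ n
⌊n*2/2⌋≡n zero    = ≡.refl
⌊n*2/2⌋≡n (suc n) = ≡.cong suc (⌊n*2/2⌋≡n n)

⌈n*2/2⌉≡n : ∀ n → ⌈ n ℕ.* 2 /2⌉ ≡ n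
⌈n*2/2⌉≡n zero    = ≡.refl
⌈n*2/2⌉≡n (suc n) = ≡.cong suc (⌈n*2/2⌉≡n n)

odd⇒1+q*2 : ∀ n → ¬ (2 ∣ n) → ∃ λ q → n ≡ suc (q ℕ.* 2)
odd⇒1+q*2 zero          2∤n = ⊥-elim (2∤n (divides 0 ≡.refl))
odd⇒1+q*2 (suc zero)    2∤n = 0 , ≡.refl
odd⇒1+q*2 (suc (suc n)) 2∤n =
  let q , n≡ = odd⇒1+q*2 n λ (divides q n≡q*2) → 2∤n (divides (suc q) (≡.cong (λ k → suc (suc k)) n≡q*2))
  in suc q , ≡.cong (λ k → suc (suc k)) n≡

open import Data.Nat.Base using (_≥_; _+_; _∸_)

theorem1p1 : ∀ {c ℓ₁ ℓ₂ : Level} (ℝ : Reals c ℓ₁ ℓ₂) (n : ℕ) → n ≥ 1 →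
    (2 ∣ n → HasInertia ℝ (betaMatrix ℝ n) (n / 2 , 0 , n / 2)) ×
    (¬ (2 ∣ n) → HasInertia ℝ (betaMatrix ℝ n) ((n + 1) / 2 , 0 , (n ∸ 1) / 2))
theorem1p1 ℝ n _ = even , odd
  where
  inertia : ∀ {p q} → ⌈ n /2⌉ ≡ p → ⌊ n /2⌋ ≡ q → HasInertia ℝ (betaMatrix ℝ n) (p , 0 , q)
  inertia ≡.refl ≡.refl = BetaDecomposition.betaMatrix-inertia ℝ n

  even : 2 ∣ n → HasInertia ℝ (betaMatrix ℝ n) (n / 2 , 0 , n / 2)
  even (divides q ≡.refl) = inertia
    (≡.trans (⌈n*2/2⌉≡n q) (≡.sym (m*n/n≡m q 2)))
    (≡.trans (⌊n*2/2⌋≡n q) (≡.sym (m*n/n≡m q 2)))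

  odd : ¬ (2 ∣ n) → HasInertia ℝ (betaMatrix ℝ n) ((n + 1) / 2 , 0 , (n ∸ 1) / 2)
  odd 2∤n with odd⇒1+q*2 n 2∤n
  -- For n = 1 + 2q the halves compute to those of 2q, as ⌈ n /2⌉ is suc ⌊ q * 2 /2⌋ and ⌊ n /2⌋ is
  -- ⌈ q * 2 /2⌉.
  ... | q , ≡.refl = inertia
    (≡.trans (≡.cong suc (⌊n*2/2⌋≡n q))
      (≡.trans (≡.sym (m*n/n≡m (suc q) 2)) (≡.cong (_/ 2) (ℕ.+-comm 1 (suc (q ℕ.* 2))))))
    (≡.trans (⌈n*2/2⌉≡n q) (≡.sym (m*n/n≡m q 2)))
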